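{- Let $K$ be an algebraically closed field of characteristic $p>0$, let $s\ge 1$ be an integer, and let $n=sp-1$. Let $A_n$ be the matrix representing the $p$-power of the Cartier operator on the Fermat curve $\mathcal{F}_n$ over $K$. Then $$\operatorname{rank}(A_{sp-1})=\begin{cases}\frac12(p-2)(p-3), & s=1,\\[2pt] \frac12(p-2)(p-3)+p(p-2), & s=2,\\[2pt] 3(p-1)^2, & s=3,\\[2pt] 3(p-1)^2+\frac14\,p\left[(p+1)s^2+(p-11)s-12(p-2)\right], & s\ge 4.\end{cases}$$
   Context: For a positive integer $n$ with $p\nmid n$, the Fermat curve $\mathcal{F}_n$ is the nonsingular projective plane curve over $K$ with affine equation $X^n+Y^n+1=0$; its function field is $K(x,y)$ with $x^n+y^n+1=0$. For a (projective, irreducible, nonsingular) curve $\mathcal{X}$ over $K$ with separating variable $x$ (i.e. $x\in K(\mathcal{X})\setminus K(\mathcal{X})^p$), every $f\in K(\mathcal{X})$ is uniquely $f=u_0^p+u_1^px+\dots+u_{p-1}^px^{p-1}$ with $u_i\in K(\mathcal{X})$; the Cartier operator is the $1/p$-linear map $\mathcal{C}(f\,dx)=u_{p-1}\,dx$ on differentials (it does not depend on $x$). It maps the finite-dimensional $K$-space $H^0(\mathcal{X},\Omega^1)$ of holomorphic differentials into itself. A basis of $H^0(\mathcal{F}_n,\Omega^1)$ is $\mathcal{B}=\{\frac{x^iy^j}{ny^{n-1}}dx : i,j\ge 0,\ i+j\le n-3\}$. Writing $\mathcal{B}=\{\omega_1,\dots,\omega_g\}$ and $\mathcal{C}(\omega_j)=\sum_i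 c_{ij}\omega_i$ with $c_{ij}\in K$, the matrix $A_n$ is $(c_{ij}^p)$. Its rank equals the rank of $(c_{ij})$, i.e. the $K$-dimension of $\mathcal{C}(H^0(\mathcal{F}_n,\Omega^1))$ (the rank of the Cartier operator). -}

module Defs where

open import Level using (Level; _⊔_) renaming (suc to lsuc)
open import Algebra.Bundles using (CommutativeRing)
open import Algebra.Morphism.Structures using (IsRingHomomorphism)
import Algebra.Properties.Semiring.Exp as Exp
import Algebra.Properties.Semiring.Mult as Mult
import Algebra.Properties.Semiring.Sum as Sum
open import Data.Bool.Base using (if_then_else_; _∧_)
open import Data.Fin.Base using (Fin; toℕ)
import Data.Integer.Base as Int
open import Data.List.Base using (List; []; _∷_; length; lookup; filter; upTo; cartesianProduct; cartesianProductWith)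
open import Data.Nat.Base as ℕ using (ℕ; suc; _∸_; _≡ᵇ_)
open import Data.Nat.Divisibility using () renaming (_∣_ to _∣ℕ_)
import Data.Nat.Properties as ℕₚ
open import Data.Product.Base using (Σ; ∃; ∃-syntax; _×_; _,_; proj₁; proj₂)
open import Data.Rational.Base as ℚ using (ℚ; _/_)
open import Data.Vec.Functional using (Vector)
open import Function.Bundles using (_⇔_)
open import Relation.Nullary.Negation.Core using (¬_)

-- The value of 0# ⁻¹ is unspecified.
record Field (c ℓ : Level) : Set (lsuc (c ⊔ ℓ)) where
  infix 8 _⁻¹
  field
    commutativeRing : CommutativeRing c ℓ
  open CommutativeRing commutativeRing public
  field
    1≉0      : ¬ (1# ≈ 0#)
    _⁻¹      : Carrier → Carrier
    ⁻¹-right : ∀ a → ¬ (a ≈ 0#) → a * a ⁻¹ ≈ 1#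
  open Exp semiring public using (_^_)
  open Mult semiring public using () renaming (_×_ to _·_)
  open Sum semiring public using (sum)

module _ {c ℓ} (K : Field c ℓ) where
  open Field K

  IsAlgebraicallyClosed : Set (c ⊔ ℓ)
  IsAlgebraicallyClosed =
    ∀ d (a : Vector Carrier (suc d)) →
    ∃[ z ] z ^ suc d + sum (λ k → a k * z ^ toℕ k) ≈ 0#

  HasCharacteristic : ℕ → Set ℓ
  HasCharacteristic p = ∀ m → (m · 1# ≈ 0#) ⇔ (p ∣ℕ m)

  -- M i j is the entry in row i and column j.
  Matrix : ℕ → ℕ → Set c
  Matrix m n = Fin m → Fin n → Carrier

  InSpan : ∀ {m r} → Vector (Vector Carrier m) r → Vector Carrier m → Set (c ⊔ ℓ)
  InSpan {r = r} b v =
    Σ (Vector Carrier r) λ a → ∀ i → v i ≈ sum (λ k → a k * b k i)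

  LinearlyIndependent : ∀ {m r} → Vector (Vector Carrier m) r → Set (c ⊔ ℓ)
  LinearlyIndependent {r = r} b =
    ∀ (a : Vector Carrier r) → (∀ i → sum (λ k → a k * b k i) ≈ 0#) → ∀ k → a k ≈ 0#

  -- The column space of M has a basis with r elements.
  HasRank : ∀ {m n} → Matrix m n → ℕ → Set (c ⊔ ℓ)
  HasRank {m} {n} M r =
    Σ (Vector (Vector Carrier m) r) λ b →
      LinearlyIndependent b × (∀ k → InSpan columns (b k)) × (∀ j → InSpan b (columns j))
    where
    columns : Vector (Vector Carrier m) n
    columns j i = M i j

  -- An element of K[X,Y] is given by a list of terms (a , i , j), standing for
  -- a X^i Y^j.  Repeated exponents and zero coefficients are allowed, so
  -- equality of polynomials is equality of all coefficients.
  Polynomial : Set c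
  Polynomial = List (Carrier × ℕ × ℕ)

  coefficient : Polynomial → ℕ → ℕ → Carrier
  coefficient []                i j = 0#
  coefficient ((a , k , l) ∷ P) i j =
    (if (k ≡ᵇ i) ∧ (l ≡ᵇ j) then a else 0#) + coefficient P i j

  infix  4 _≈ₚ_ _∣ₚ_
  infixl 7 _*ₚ_

  _≈ₚ_ : Polynomial → Polynomial → Set ℓ
  P ≈ₚ Q = ∀ i j → coefficient P i j ≈ coefficient Q i j

  _*ₚ_ : Polynomial → Polynomial → Polynomial
  _*ₚ_ = cartesianProductWith λ (a , i , j) (b , k , l) → a * b , i ℕ.+ k , j ℕ.+ l

  _∣ₚ_ : Polynomial → Polynomial → Set (c ⊔ ℓ)
  P ∣ₚ G = ∃[ Q ] P *ₚ Q ≈ₚ G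

  fermat : ℕ → Polynomial
  fermat n = (1# , n , 0) ∷ (1# , 0 , n) ∷ (1# , 0 , 0) ∷ []

-- P(x , y), the coefficients being mapped to F by ι.
evaluate : ∀ {c ℓ c′ ℓ′} (K : Field c ℓ) (F : Field c′ ℓ′) →
           (Field.Carrier K → Field.Carrier F) → (x y : Field.Carrier F) →
           Polynomial K → Field.Carrier F
evaluate K F ι x y = go
  where
  open Field F
  go : Polynomial K → Carrier
  go []                = 0#
  go ((a , i , j) ∷ P) = ι a * x ^ i * y ^ j + go P

-- F is the fraction field of the coordinate ring K[X,Y]/(Xⁿ + Yⁿ + 1), with x
-- and y the classes of X and Y.
record FermatFunctionField {c ℓ} (K : Field c ℓ) (n : ℕ) (c′ ℓ′ : Level)
       : Set (c ⊔ ℓ ⊔ lsuc (c′ ⊔ ℓ′)) where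
  private module K = Field K
  field
    functionField : Field c′ ℓ′
  open Field functionField public
  field
    ι     : K.Carrier → Carrier
    ι-hom : IsRingHomomorphism K.rawRing rawRing ι
    x y   : Carrier

  private
    eval : Polynomial K → Carrier
    eval = evaluate K functionField ι x y
  field
    vanishes⇔ : ∀ G → (eval G ≈ 0#) ⇔ (_∣ₚ_ K (fermat K n) G)
    fraction  : ∀ f → ∃[ G ] ∃[ H ] (¬ (eval H ≈ 0#)) × (f ≈ eval G * eval H ⁻¹)

-- The exponents (i , j) with i + j ≤ n - 3; written additively so that there
-- are none when n < 3.
exponents : ℕ → List (ℕ × ℕ)
exponents n =
  filter (λ (i , j) → i ℕ.+ j ℕ.+ 3 ℕₚ.≤? n) (cartesianProduct (upTo n) (upTo n))

genus : ℕ → ℕ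
genus n = length (exponents n)

module _ {c ℓ} {K : Field c ℓ} {n : ℕ} {c′ ℓ′} (FF : FermatFunctionField K n c′ ℓ′) where
  private module K = Field K
  open FermatFunctionField FF

  -- As x is a separating variable, the differentials form the one-dimensional
  -- F-space F dx; f dx stands for the differential f · dx.
  record Differential : Set c′ where
    constructor _dx
    field coeff : Carrier
  open Differential

  infix 4 _≈Ω_
  _≈Ω_ : Differential → Differential → Set ℓ′
  ω ≈Ω η = coeff ω ≈ coeff η

  combination : ∀ {r} → Vector K.Carrier r → Vector Differential r → Differential
  combination a ω = sum (λ k → ι (a k) * coeff (ω k)) dx

  -- Every f has exactly one expansion Σ_{k<p} u_k^p x^k, so this determines C.
  -- Only the values u 0, …, u (p - 1) matter.
  IsCartierOperator : ℕ → (Differential → Differential) → Set (c′ ⊔ ℓ′)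
  IsCartierOperator p C =
    ∀ f (u : ℕ → Carrier) →
    f ≈ sum {p} (λ k → u (toℕ k) ^ p * x ^ toℕ k) →
    C (f dx) ≈Ω (u (p ∸ 1) dx)

  ω : Vector Differential (genus n)
  ω k = let (i , j) = lookup (exponents n) k in
        (x ^ i * y ^ j * (n · y ^ (n ∸ 1)) ⁻¹) dx

  -- C(ω_j) = Σ_i c_ij ω_i.
  IsMatrixOf : (Differential → Differential) → Matrix K (genus n) (genus n) → Set ℓ′
  IsMatrixOf C M = ∀ j → C (ω j) ≈Ω combination (λ i → M i j) ω

entrywisePower : ∀ {c ℓ} (K : Field c ℓ) {m n} → ℕ → Matrix K m n → Matrix K m n
entrywisePower K p M i j = M i j ^ p
  where open Field K

-- Meant for 1 ≤ s; the last clause is the case 4 ≤ s.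
rankFormula : (p s : ℕ) → ℚ
rankFormula p s = go s
  where
  open Int using (ℤ; +_; _+_; _-_; _*_)
  P S : ℤ
  P = + p
  S = + s
  go : ℕ → ℚ
  go 1 = ((P - + 2) * (P - + 3)) / 2
  go 2 = ((P - + 2) * (P - + 3)) / 2 ℚ.+ (P * (P - + 2)) / 1
  go 3 = (+ 3 * ((P - + 1) * (P - + 1))) / 1
  go _ = (+ 3 * ((P - + 1) * (P - + 1))) / 1
         ℚ.+ (P * ((P + + 1) * (S * S) + (P - + 11) * S - + 12 * (P - + 2))) / 4

{-# OPTIONS --safe #-}

-- Put a = i + 1 and b = j + 1, and write a = k + q p, b = l + t p in base p.
-- As yⁿ = -(1 + xⁿ) and n ≡ -1 (mod p), xⁱ yʲ / yⁿ⁻¹ is, up to a constant, a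
-- p-th power times xⁱ (1 + xⁿ)ᵐ with m = p - 1 - l.  The exponents i + n h,
-- h < p, are distinct modulo p, and only h = k gives p - 1; so the Cartier
-- operator sends the form with indices (a , b) to a constant multiple of the one
-- with indices (q + s k , t + s l), and the constant is essentially the binomial
-- coefficient (m choose k), nonzero iff k + l < p.  This map on indices exchanges
-- the roles of the digits in bases p and s, so it is injective, and the rank is
-- the number of pairs a, b ≥ 1 with a + b < n whose digits add without carry.
-- Among all a, b ≥ 0 with a + b ≤ n there are (s + 1 choose 2) (p + 1 choose 2)
-- such pairs; the 3 n on the boundary of the triangle are all of this kind.

module Submission where

open import Defs
open import Algebra.Bundles using (CommutativeMonoid)
open import Algebra.Morphism.Structures using (IsRingHomomorphism)
import Algebra.Properties.CommutativeMonoid.Sum as CommutativeMonoidSum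
import Algebra.Properties.CommutativeSemiring.Binomial as Binomial
import Algebra.Properties.CommutativeSemiring.Exp as Exp
import Algebra.Properties.Group as GroupProperties
import Algebra.Properties.Semiring.Mult as Mult
import Algebra.Properties.Semiring.Sum as SemiringSum
import Algebra.Solver.CommutativeMonoid as CommutativeMonoidSolver
open import Data.Bool.Base using (true; false; if_then_else_; _∧_; T)
import Data.Bool.Properties as Boolₚ
open import Data.Fin.Base as Fin using (Fin; zero; suc; toℕ; fromℕ<)
open import Data.Fin.Permutation using (Permutation′; permutation; _⟨$⟩ʳ_)
import Data.Fin.Properties as Finₚ
import Data.Integer.Base as Int
import Data.Integer.Properties as ℤₚ
import Data.Integer.Tactic.RingSolver as ℤSolver
open import Data.List.Base using (List; []; _∷_; _++_; map; tabulate; length; lookup; filter; allFin; applyUpTo; upTo; cartesianProduct)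
open import Data.List.Membership.Propositional using (_∈_)
open import Data.List.Membership.Propositional.Properties using (∈-lookup; ∈-filter⁺; ∈-filter⁻; ∈-allFin; ∈-cartesianProduct⁺; ∈-upTo⁺)
import Data.List.Properties as Listₚ
import Data.List.Relation.Unary.All as All
open import Data.List.Relation.Unary.All.Properties using (all-filter)
open import Data.List.Relation.Unary.AllPairs using (_∷_)
open import Data.List.Relation.Unary.Any using (index)
open import Data.List.Relation.Unary.Any.Properties using (lookup-index)
open import Data.List.Relation.Unary.Unique.Propositional using (Unique)
import Data.List.Relation.Unary.Unique.Propositional.Properties as Uniqueₚ
open import Data.Nat.Base as ℕ using (ℕ; zero; suc; pred; _∸_; _<_; _≤_; z≤n; s≤s; _!; _≡ᵇ_; _⊔_; NonZero)
open import Data.Nat.Combinatorics using (nCk≡n!/k![n-k]!; k>n⇒nCk≡0; k![n∸k]!∣n!) renaming (_C_ to _choose_)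
open import Data.Nat.Divisibility using (_∣_; divides; ∣⇒≤; ∣-refl; ∣m+n∣m⇒∣n; n∣m*n)
import Data.Nat.DivMod as DivMod
import Data.Nat.Properties as ℕₚ
open import Data.Nat.Tactic.RingSolver using (solve-∀)
open import Data.Product.Base using (∃-syntax; _×_; _,_; proj₁; proj₂)
open import Data.Rational.Base as ℚ using (ℚ; fromℚᵘ)
import Data.Rational.Properties as ℚₚ
open import Data.Rational.Unnormalised.Base as ℚᵘ using (ℚᵘ; mkℚᵘ; *≡*)
import Data.Rational.Unnormalised.Properties as ℚᵘₚ
open import Data.Sum.Base using (_⊎_; inj₁; inj₂)
open import Data.Vec.Functional using (Vector)
open import Function.Base using (_∘_; id)
open import Function.Bundles using (module Equivalence)
open import Relation.Binary.Definitions using (tri<; tri≈; tri>)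
open import Relation.Binary.PropositionalEquality as ≡ using (_≡_; _≢_; cong; cong₂; subst; module ≡-Reasoning)
import Relation.Binary.Reasoning.Setoid as SetoidReasoning
open import Relation.Nullary using (¬_; Dec; yes; no; does; contradiction)
open import Relation.Nullary.Decidable using (_×-dec_)
open import Relation.Unary using (Pred; Decidable)
open import Relation.Unary.Properties using (_∩?_)

-- The operator is specified only by its values on expansions f = Σ u_r^p x^r, so all p coefficients
-- u_r have to be exhibited, not just the last one. Each constant must then be a p-th power in K,
-- and this is where algebraic closure enters. A column of the matrix is given as an identity
-- between differentials. To read its entries off, the basis forms must be independent over K.
-- Clearing the denominator n y^(n-1) reduces this to monomials of X-degree below n, none of whose
-- nontrivial combinations is divisible by X^n + Y^n + 1, a polynomial monic in X of degree n. The
-- result is a matrix with at most one nonzero entry in each column and in each row. In the count,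
-- the boundary of the triangle is added first and removed afterwards because a + b < s p, unlike a
-- + b < n, splits into separate conditions on the upper and the lower digits once there is no
-- carry.

module _ {c ℓ} (M : CommutativeMonoid c ℓ) where
  open CommutativeMonoid M
    renaming (refl to ≈-refl; sym to ≈-sym; trans to ≈-trans)
  open CommutativeMonoidSum M

  sum-zero : ∀ {n} (t : Vector Carrier n) → (∀ k → t k ≈ ε) → sum t ≈ ε
  sum-zero {n} t t≈ε = ≈-trans (sum-cong-≋ t≈ε) (sum-replicate-zero n)

  sum-select : ∀ {n} (t : Vector Carrier n) i → (∀ k → k ≢ i → t k ≈ ε) → sum t ≈ t i
  sum-select t zero t≈ε =
    ≈-trans (∙-congˡ (sum-zero (t ∘ suc) λ k → t≈ε (suc k) λ ())) (identityʳ _)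
  sum-select t (suc i) t≈ε =
    ≈-trans (∙-cong (t≈ε zero λ ()) (sum-select (t ∘ suc) i λ k k≢i → t≈ε (suc k) (k≢i ∘ Finₚ.suc-injective)))
            (identityˡ _)

  sum-split : ∀ m n (f : ℕ → Carrier) →
    ∑[ k < m ℕ.+ n ] f (toℕ k) ≈ (∑[ k < m ] f (toℕ k)) ∙ (∑[ k < n ] f (m ℕ.+ toℕ k))
  sum-split zero    n f = ≈-sym (identityˡ _)
  sum-split (suc m) n f = ≈-trans (∙-congˡ (sum-split m n (f ∘ suc))) (≈-sym (assoc _ _ _))

-- Counting index pairs whose last base p digits add without carry.

module Counting where
  open import Data.Nat.Tactic.RingSolver using (solve)
  open DivMod using (_/_; _%_)
  open import Data.Nat.Base using (_+_; _*_)
  open SemiringSum ℕₚ.+-*-semiring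
    using (∑-distrib-+; *-distribˡ-sum; *-distribʳ-sum; sum-cong-≗; sum-syntax; sum)

  indicator : ∀ {a} {A : Set a} → Dec A → ℕ
  indicator A? = if does A? then 1 else 0

  indicator-yes : ∀ {a} {A : Set a} (A? : Dec A) → A → indicator A? ≡ 1
  indicator-yes (yes _) _ = ≡.refl
  indicator-yes (no ¬x) x = contradiction x ¬x

  indicator-no : ∀ {a} {A : Set a} (A? : Dec A) → ¬ A → indicator A? ≡ 0
  indicator-no (yes x) ¬x = contradiction x ¬x
  indicator-no (no _)  _  = ≡.refl

  indicator-cong : ∀ {a b} {A : Set a} {B : Set b} (A? : Dec A) (B? : Dec B) →
    (A → B) → (B → A) → indicator A? ≡ indicator B?
  indicator-cong (yes x) B? f g = ≡.sym (indicator-yes B? (f x))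
  indicator-cong (no ¬x) B? f g = ≡.sym (indicator-no B? (¬x ∘ g))

  indicator-× : ∀ {a b} {A : Set a} {B : Set b} (A? : Dec A) (B? : Dec B) →
    indicator (A? ×-dec B?) ≡ indicator A? * indicator B?
  indicator-× (yes _) (yes _) = ≡.refl
  indicator-× (yes _) (no _)  = ≡.refl
  indicator-× (no _)  (yes _) = ≡.refl
  indicator-× (no _)  (no _)  = ≡.refl

  -- Two conditions may be compared under the assumption of a third one that multiplies them; a + b
  -- < s p and q + t < s are equivalent only in the absence of a carry.
  *-indicator-cong : ∀ {a} {A : Set a} (A? : Dec A) {x y} → (A → x ≡ y) →
    x * indicator A? ≡ y * indicator A?
  *-indicator-cong (yes a) x≡y     = cong (_* 1) (x≡y a)
  *-indicator-cong (no _) {x} {y} _ = ≡.trans (ℕₚ.*-zeroʳ x) (≡.sym (ℕₚ.*-zeroʳ y))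

  ∑-ones : ∀ n (t : Vector ℕ n) → (∀ k → t k ≡ 1) → sum t ≡ n
  ∑-ones zero    t t≡1 = ≡.refl
  ∑-ones (suc n) t t≡1 = cong₂ _+_ (t≡1 zero) (∑-ones n (t ∘ suc) (t≡1 ∘ suc))

  ∑-below : ∀ n k → k ≤ n → ∑[ j < n ] indicator (toℕ j ℕₚ.<? k) ≡ k
  ∑-below n       zero    _         = sum-zero ℕₚ.+-0-commutativeMonoid {n} _ λ _ → ≡.refl
  ∑-below (suc n) (suc k) (s≤s k≤n) = cong suc (≡.trans
    (sum-cong-≗ {n} λ j → indicator-cong (suc (toℕ j) ℕₚ.<? suc k) (toℕ j ℕₚ.<? k) ℕ.s<s⁻¹ s≤s)
    (∑-below n k k≤n))

  -- The triangular number m (m + 1) / 2, kept as a double sum because the digits of a pair produce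
  -- it in this shape.
  triangle : ℕ → ℕ
  triangle m = ∑[ i < m ] ∑[ j < m ] indicator (toℕ i + toℕ j ℕₚ.<? m)

  2*triangle : ∀ m → 2 * triangle m ≡ m * suc m
  2*triangle m = ≡.trans (cong (2 *_) (sum-cong-≗ {m} row)) (column m)
    where
    row : ∀ (i : Fin m) → ∑[ j < m ] indicator (toℕ i + toℕ j ℕₚ.<? m) ≡ m ∸ toℕ i
    row i = ≡.trans
      (sum-cong-≗ {m} λ j → indicator-cong (toℕ i + toℕ j ℕₚ.<? m) (toℕ j ℕₚ.<? m ∸ toℕ i)
        (λ lt → ℕₚ.m+n≤o⇒m≤o∸n (suc (toℕ j)) (subst (_< m) (ℕₚ.+-comm (toℕ i) (toℕ j)) lt))
        (λ lt → subst (_< m) (ℕₚ.+-comm (toℕ j) (toℕ i))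
                  (ℕₚ.m≤o∸n⇒m+n≤o (suc (toℕ j)) (ℕₚ.<⇒≤ (Finₚ.toℕ<n i)) lt)))
      (∑-below m (m ∸ toℕ i) (ℕₚ.m∸n≤m m (toℕ i)))

    column : ∀ m → 2 * (∑[ i < m ] (m ∸ toℕ i)) ≡ m * suc m
    column zero    = ≡.refl
    column (suc m) = begin
      2 * (suc m + ∑[ i < m ] (m ∸ toℕ i))      ≡⟨ ℕₚ.*-distribˡ-+ 2 (suc m) _ ⟩
      2 * suc m + 2 * (∑[ i < m ] (m ∸ toℕ i))  ≡⟨ cong (2 * suc m +_) (column m) ⟩
      2 * suc m + m * suc m                     ≡⟨ solve (m ∷ []) ⟩
      suc m * suc (suc m)                       ∎
      where open ≡-Reasoning

  length-filter-applyUpTo : ∀ {a p} {A : Set a} {P : Pred A p} (P? : Decidable P) (f : ℕ → A) n →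
    length (filter P? (applyUpTo f n)) ≡ ∑[ i < n ] indicator (P? (f (toℕ i)))
  length-filter-applyUpTo P? f zero    = ≡.refl
  length-filter-applyUpTo P? f (suc n) with P? (f 0)
  ... | yes _ = cong suc (length-filter-applyUpTo P? (f ∘ suc) n)
  ... | no _  = length-filter-applyUpTo P? (f ∘ suc) n

  -- The general `f` serves the induction: the tail of `upTo (suc m)` is `applyUpTo suc m`.
  length-filter-cartesianProduct :
    ∀ {a p} {A : Set a} {P : Pred (A × ℕ) p} (P? : Decidable P) (f : ℕ → A) m n →
    length (filter P? (cartesianProduct (applyUpTo f m) (upTo n))) ≡
    ∑[ i < m ] ∑[ j < n ] indicator (P? (f (toℕ i) , toℕ j))
  length-filter-cartesianProduct P? f zero    n = ≡.refl
  length-filter-cartesianProduct P? f (suc m) n = begin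
    length (filter P? (map (f 0 ,_) (upTo n) ++ rest))
      ≡⟨ cong length (Listₚ.filter-++ P? (map (f 0 ,_) (upTo n)) rest) ⟩
    length (filter P? (map (f 0 ,_) (upTo n)) ++ filter P? rest)
      ≡⟨ Listₚ.length-++ (filter P? (map (f 0 ,_) (upTo n))) ⟩
    length (filter P? (map (f 0 ,_) (upTo n))) + length (filter P? rest)
      ≡⟨ cong₂ _+_
           (≡.trans (cong (length ∘ filter P?) (Listₚ.map-upTo (f 0 ,_) n))
                    (length-filter-applyUpTo P? (f 0 ,_) n))
           (length-filter-cartesianProduct P? (f ∘ suc) m n) ⟩
    _ ∎
    where
    open ≡-Reasoning
    rest = cartesianProduct (applyUpTo (f ∘ suc) m) (upTo n)

  length-filter-∩ : ∀ {a p q} {A : Set a} {P : Pred A p} {Q : Pred A q}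
    (P? : Decidable P) (Q? : Decidable Q) xs →
    length (filter P? (filter Q? xs)) ≡ length (filter (Q? ∩? P?) xs)
  length-filter-∩ P? Q? []       = ≡.refl
  length-filter-∩ P? Q? (x ∷ xs) with Q? x
  ... | no _ = length-filter-∩ P? Q? xs
  ... | yes _ with P? x
  ...   | yes _ = cong suc (length-filter-∩ P? Q? xs)
  ...   | no _  = length-filter-∩ P? Q? xs

  ∑-blocks : ∀ s p (f : ℕ → ℕ) →
    ∑[ a < s * p ] f (toℕ a) ≡ ∑[ q < s ] ∑[ k < p ] f (toℕ k + toℕ q * p)
  ∑-blocks zero    p f = ≡.refl
  ∑-blocks (suc s) p f = ≡.trans (sum-split ℕₚ.+-0-commutativeMonoid p (s * p) f) (cong₂ _+_
    (sum-cong-≗ {p} λ k → cong f (≡.sym (ℕₚ.+-identityʳ (toℕ k))))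
    (≡.trans (∑-blocks s p (f ∘ (p +_)))
             (sum-cong-≗ {s} λ q → sum-cong-≗ {p} λ k → cong f (swap p (toℕ k) (toℕ q * p)))))
    where
    swap : ∀ a b c → a + (b + c) ≡ b + (a + c)
    swap = solve-∀

  ∑-product : ∀ {m n} (f : Vector ℕ m) (g : Vector ℕ n) →
    ∑[ i < m ] ∑[ j < n ] (f i * g j) ≡ sum f * sum g
  ∑-product {m} f g = ≡.trans (sum-cong-≗ {m} λ i → ≡.sym (*-distribˡ-sum (f i) g)) (≡.sym (*-distribʳ-sum (sum g) f))

  module Digits (p : ℕ) .{{_ : NonZero p}} where

    %-digit : ∀ k q → k < p → (k + q * p) % p ≡ k
    %-digit k q k<p = ≡.trans (DivMod.[m+kn]%n≡m%n k q p) (DivMod.m<n⇒m%n≡m k<p)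

    -- Only the carry out of the last digit counts. For a < s p the quotient a / p is treated as one
    -- upper digit, which ranges below s.
    CarryFree : ℕ → ℕ → Set
    CarryFree a b = a % p + b % p < p

    carryFree? : ∀ a b → Dec (CarryFree a b)
    carryFree? a b = a % p + b % p ℕₚ.<? p

    carry-free-sum : ∀ s k q l t → k + l < p →
      (k + q * p) + (l + t * p) < s * p → q + t < s
    carry-free-sum s k q l t _ lt = ℕₚ.*-cancelʳ-< p (q + t) s (ℕₚ.≤-<-trans bound lt)
      where
      bound : (q + t) * p ≤ (k + q * p) + (l + t * p)
      bound = ℕₚ.≤-trans (ℕₚ.m≤n+m _ (k + l)) (ℕₚ.≤-reflexive (solve (k ∷ l ∷ q ∷ t ∷ p ∷ [])))

    sum-of-quotients : ∀ s k q l t → k + l < p → q + t < s →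
      (k + q * p) + (l + t * p) < s * p
    sum-of-quotients s k q l t k+l<p q+t<s = begin-strict
      (k + q * p) + (l + t * p)  ≡⟨ solve (k ∷ l ∷ q ∷ t ∷ p ∷ []) ⟩
      (k + l) + (q + t) * p      <⟨ ℕₚ.+-monoˡ-< _ k+l<p ⟩
      suc (q + t) * p            ≤⟨ ℕₚ.*-monoˡ-≤ p q+t<s ⟩
      s * p                      ∎
      where open ℕₚ.≤-Reasoning

    belowCarryFree : ℕ → ℕ → ℕ → ℕ
    belowCarryFree N a b = indicator (a + b ℕₚ.<? N) * indicator (carryFree? a b)

    -- Without a carry, (k + l) + (q + t) p is the division of the sum by p with remainder, so
    -- comparing the sum with s p means comparing q + t with s. The two resulting conditions involve
    -- disjoint digits, which later turns the sum over all pairs into a product.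
    belowCarryFree-digits : ∀ s {q k t l} → k < p → l < p →
      belowCarryFree (s * p) (k + q * p) (l + t * p) ≡
      indicator (q + t ℕₚ.<? s) * indicator (k + l ℕₚ.<? p)
    belowCarryFree-digits s {q} {k} {t} {l} k<p l<p
      rewrite %-digit k q k<p | %-digit l t l<p =
      *-indicator-cong (k + l ℕₚ.<? p) λ k+l<p →
        indicator-cong ((k + q * p) + (l + t * p) ℕₚ.<? s * p) (q + t ℕₚ.<? s)
          (carry-free-sum s k q l t k+l<p) (sum-of-quotients s k q l t k+l<p)

    ∑-belowCarryFree : ∀ s → ∑[ a < s * p ] ∑[ b < s * p ] belowCarryFree (s * p) (toℕ a) (toℕ b) ≡
                      triangle s * triangle p
    ∑-belowCarryFree s = begin
      ∑[ a < s * p ] ∑[ b < s * p ] D (toℕ a) (toℕ b)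
        ≡⟨ ∑-blocks s p (λ a → ∑[ b < s * p ] D a (toℕ b)) ⟩
      ∑[ q < s ] ∑[ k < p ] ∑[ b < s * p ] D (toℕ k + toℕ q * p) (toℕ b)
        ≡⟨ (sum-cong-≗ {s} λ q → sum-cong-≗ {p} λ k →
             ≡.trans (∑-blocks s p (D (toℕ k + toℕ q * p)))
                     (sum-cong-≗ {s} λ t → sum-cong-≗ {p} λ l →
                       belowCarryFree-digits s {toℕ q} {toℕ k} {toℕ t} {toℕ l} (Finₚ.toℕ<n k) (Finₚ.toℕ<n l))) ⟩
      ∑[ q < s ] ∑[ k < p ] ∑[ t < s ] ∑[ l < p ] (A q t * B k l)
        ≡⟨ (sum-cong-≗ {s} λ q → sum-cong-≗ {p} λ k → ∑-product (A q) (B k)) ⟩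
      ∑[ q < s ] ∑[ k < p ] (sum (A q) * sum (B k))
        ≡⟨ ∑-product {s} {p} (λ q → sum (A q)) (λ k → sum (B k)) ⟩
      triangle s * triangle p ∎
      where
      open ≡-Reasoning
      D = belowCarryFree (s * p)
      A : Fin s → Fin s → ℕ
      A q t = indicator (toℕ q + toℕ t ℕₚ.<? s)
      B : Fin p → Fin p → ℕ
      B k l = indicator (toℕ k + toℕ l ℕₚ.<? p)

    -- The last digits of a and b then add up to p - 1.
    carryFree-complement : ∀ s a b → suc (a + b) ≡ s * p → CarryFree a b
    carryFree-complement s a b 1+a+b≡s*p = multiple (∣m+n∣m⇒∣n p∣sum (n∣m*n (a / p + b / p)))
      where
      k = a % p
      l = b % p
      rearrange : ∀ p k l q t → suc ((k + q * p) + (l + t * p)) ≡ (q + t) * p + suc (k + l)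
      rearrange = solve-∀
      p∣sum : p ∣ (a / p + b / p) * p + suc (k + l)
      p∣sum = divides s (begin
        (a / p + b / p) * p + suc (k + l)        ≡⟨ rearrange p k l (a / p) (b / p) ⟨
        suc ((k + a / p * p) + (l + b / p * p))  ≡⟨ cong₂ (λ u v → suc (u + v)) (DivMod.m≡m%n+[m/n]*n a p) (DivMod.m≡m%n+[m/n]*n b p) ⟨
        suc (a + b)                              ≡⟨ 1+a+b≡s*p ⟩
        s * p                                    ∎)
        where open ≡-Reasoning
      multiple : p ∣ suc (k + l) → k + l < p
      multiple (divides 1 eq) = ℕₚ.≤-reflexive (≡.trans eq (ℕₚ.+-identityʳ p))
      multiple (divides (suc (suc c)) eq) = contradiction
        (ℕₚ.≤-trans (ℕₚ.+-monoʳ-≤ p (ℕₚ.m≤m+n p (c * p))) (ℕₚ.≤-reflexive (≡.sym eq)))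
        (ℕₚ.<⇒≱ (ℕₚ.+-mono-≤-< (DivMod.m%n<n a p) (DivMod.m%n<n b p)))

    -- The forms that the Cartier operator does not annihilate.
    Surviving : ℕ × ℕ → Set
    Surviving (i , j) = CarryFree (suc i) (suc j)

    surviving? : Decidable Surviving
    surviving? (i , j) = carryFree? (suc i) (suc j)

    module _ (s n : ℕ) (1+n≡s*p : suc n ≡ s * p) where

      survivors : ℕ
      survivors = length (filter surviving? (exponents n))

      private
        E : ℕ → ℕ → ℕ
        E i j = indicator (i + j + 3 ℕₚ.≤? n) * indicator (surviving? (i , j))

        survivors≡∑ : survivors ≡ ∑[ i < n ] ∑[ j < n ] E (toℕ i) (toℕ j)
        survivors≡∑ = ≡.trans (length-filter-∩ surviving? (λ (i , j) → i + j + 3 ℕₚ.≤? n) (cartesianProduct (upTo n) (upTo n)))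
          (≡.trans (length-filter-cartesianProduct _ id n n)
            (sum-cong-≗ {n} λ i → sum-cong-≗ {n} λ j → indicator-× (toℕ i + toℕ j + 3 ℕₚ.≤? n) (surviving? (toℕ i , toℕ j))))

        shift : ∀ i j → suc (suc i + suc j) ≡ i + j + 3
        shift = solve-∀

        D : ℕ → ℕ → ℕ
        D = belowCarryFree (suc n)

        -- For a = i + 1 and b = j + 1, the condition a + b ≤ n splits into a + b < n, which says i
        -- + j + 3 ≤ n, and a + b = n, where a carry never occurs.
        interior : ∀ i j → D (suc i) (suc j) ≡ E i j + indicator (suc i + suc j ℕₚ.≟ n)
        interior i j with ℕₚ.<-cmp (suc i + suc j) n
        ... | tri< lt ≢ _ = ≡.trans
          (cong (_* indicator (surviving? (i , j))) (≡.trans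
            (indicator-yes (suc i + suc j ℕₚ.<? suc n) (ℕₚ.m<n⇒m<1+n lt))
            (≡.sym (indicator-yes (i + j + 3 ℕₚ.≤? n) (subst (_≤ n) (shift i j) lt)))))
          (≡.sym (≡.trans (cong (E i j +_) (indicator-no (suc i + suc j ℕₚ.≟ n) ≢)) (ℕₚ.+-identityʳ _)))
        ... | tri≈ ≮ ≡n _ = ≡.trans
          (cong₂ _*_ (indicator-yes (suc i + suc j ℕₚ.<? suc n) (s≤s (ℕₚ.≤-reflexive ≡n)))
                       (indicator-yes (surviving? (i , j)) (carryFree-complement s (suc i) (suc j) (≡.trans (cong suc ≡n) 1+n≡s*p))))
          (≡.sym (cong₂ _+_ (cong (_* indicator (surviving? (i , j)))
                               (indicator-no (i + j + 3 ℕₚ.≤? n) (≮ ∘ subst (_≤ n) (≡.sym (shift i j)))))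
                             (indicator-yes (suc i + suc j ℕₚ.≟ n) ≡n)))
        ... | tri> ≮ ≢ gt = ≡.trans
          (cong (_* indicator (surviving? (i , j))) (≡.trans
            (indicator-no (suc i + suc j ℕₚ.<? suc n) (ℕₚ.<⇒≱ gt ∘ ℕ.s≤s⁻¹))
            (≡.sym (indicator-no (i + j + 3 ℕₚ.≤? n) (≮ ∘ subst (_≤ n) (≡.sym (shift i j)))))))
          (≡.sym (≡.trans (cong (E i j +_) (indicator-no (suc i + suc j ℕₚ.≟ n) ≢)) (ℕₚ.+-identityʳ _)))

        0%p≡0 : 0 % p ≡ 0
        0%p≡0 = DivMod.m<n⇒m%n≡m (ℕ.>-nonZero⁻¹ p)

        left-edge : ∀ b → b < suc n → D 0 b ≡ 1
        left-edge b b≤n = cong₂ _*_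
          (indicator-yes (b ℕₚ.<? suc n) b≤n)
          (indicator-yes (carryFree? 0 b) (subst (λ k → k + b % p < p) (≡.sym 0%p≡0) (DivMod.m%n<n b p)))

        bottom-edge : ∀ a → a < suc n → D a 0 ≡ 1
        bottom-edge a a≤n = cong₂ _*_
          (indicator-yes (a + 0 ℕₚ.<? suc n) (subst (_< suc n) (≡.sym (ℕₚ.+-identityʳ a)) a≤n))
          (indicator-yes (carryFree? a 0) (subst (_< p)
            (≡.sym (≡.trans (cong (a % p +_) 0%p≡0) (ℕₚ.+-identityʳ (a % p)))) (DivMod.m%n<n a p)))

        antidiagonal-row : ∀ i → ∑[ j < n ] indicator (suc i + suc (toℕ j) ℕₚ.≟ n) ≡ indicator (suc i ℕₚ.<? n)
        antidiagonal-row i with suc i ℕₚ.<? n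
        ... | no i≮n = ≡.trans
          (sum-zero ℕₚ.+-0-commutativeMonoid {n} _ λ j →
            indicator-no (suc i + suc (toℕ j) ℕₚ.≟ n)
              λ eq → i≮n (subst (suc i <_) eq (ℕₚ.m<m+n (suc i) (s≤s z≤n))))
          (≡.sym (indicator-no (suc i ℕₚ.<? n) i≮n))
        ... | yes i<n with ℕₚ.m≤n⇒∃[o]m+o≡n i<n
        ...   | o , 2+i+o≡n = ≡.trans
          (sum-select ℕₚ.+-0-commutativeMonoid {n} _ (fromℕ< o<n) λ j j≢o →
            indicator-no (suc i + suc (toℕ j) ℕₚ.≟ n) λ eq → j≢o (Finₚ.toℕ-injective (≡.trans
              (ℕₚ.suc-injective (ℕₚ.+-cancelˡ-≡ (suc i) _ _ (≡.trans eq (≡.sym hit)))) (≡.sym (Finₚ.toℕ-fromℕ< o<n)))))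
          (≡.trans (indicator-yes (suc i + suc (toℕ (fromℕ< o<n)) ℕₚ.≟ n)
                     (≡.trans (cong (λ k → suc i + suc k) (Finₚ.toℕ-fromℕ< o<n)) hit))
                   (≡.sym (indicator-yes (suc i ℕₚ.<? n) i<n)))
          where
          hit : suc i + suc o ≡ n
          hit = ≡.trans (ℕₚ.+-suc (suc i) o) 2+i+o≡n
          o<n : o < n
          o<n = subst (o <_) hit (ℕₚ.m≤n+m (suc o) (suc i))

        antidiagonal : ∀ m → ∑[ i < m ] indicator (suc (toℕ i) ℕₚ.<? m) ≡ m ∸ 1
        antidiagonal zero    = ≡.refl
        antidiagonal (suc m) = ≡.trans
          (sum-cong-≗ {suc m} λ i → indicator-cong (suc (toℕ i) ℕₚ.<? suc m) (toℕ i ℕₚ.<? m) ℕ.s<s⁻¹ s≤s)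
          (∑-below (suc m) m (ℕₚ.n≤1+n m))

        -- The corner (0 , 0) is counted with the edge a = 0, which leaves n points on b = 0. The
        -- corners on the axes are then used up, which leaves n - 1 points on a + b = n.
        decomposition : ∑[ a < suc n ] ∑[ b < suc n ] D (toℕ a) (toℕ b) ≡ suc n + (n + (survivors + (n ∸ 1)))
        decomposition = cong₂ _+_
          (∑-ones (suc n) _ λ b → left-edge (toℕ b) (Finₚ.toℕ<n b))
          (begin
            ∑[ i < n ] (D (suc (toℕ i)) 0 + (∑[ j < n ] D (suc (toℕ i)) (suc (toℕ j))))
              ≡⟨ ∑-distrib-+ {n} _ _ ⟩
            (∑[ i < n ] D (suc (toℕ i)) 0) + (∑[ i < n ] ∑[ j < n ] D (suc (toℕ i)) (suc (toℕ j)))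
              ≡⟨ cong₂ _+_ (∑-ones n _ λ i → bottom-edge (suc (toℕ i)) (s≤s (Finₚ.toℕ<n i)))
                   (sum-cong-≗ {n} λ i → ≡.trans (sum-cong-≗ {n} λ j → interior (toℕ i) (toℕ j)) (∑-distrib-+ {n} _ _)) ⟩
            n + (∑[ i < n ] ((∑[ j < n ] E (toℕ i) (toℕ j)) + (∑[ j < n ] indicator (suc (toℕ i) + suc (toℕ j) ℕₚ.≟ n))))
              ≡⟨ cong (n +_) (∑-distrib-+ {n} _ _) ⟩
            n + ((∑[ i < n ] ∑[ j < n ] E (toℕ i) (toℕ j)) + (∑[ i < n ] ∑[ j < n ] indicator (suc (toℕ i) + suc (toℕ j) ℕₚ.≟ n)))
              ≡⟨ cong (n +_) (cong₂ _+_ (≡.sym survivors≡∑)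
                   (≡.trans (sum-cong-≗ {n} λ i → antidiagonal-row (toℕ i)) (antidiagonal n))) ⟩
            n + (survivors + (n ∸ 1)) ∎)
          where open ≡-Reasoning

      -- The factor 4 clears the halves of the two triangular numbers, and 12 n is four times the
      -- boundary count 3 n. The hypothesis 1 ≤ n makes `n ∸ 1` a true subtraction.
      4*survivors : 1 ≤ n → 4 * survivors + 12 * n ≡ (s * suc s) * (p * suc p)
      4*survivors (s≤s {n = m} _) = begin
        4 * survivors + 12 * suc m                     ≡⟨ regroup survivors m ⟩
        4 * (suc (suc m) + (suc m + (survivors + m)))  ≡⟨ cong (4 *_) decomposition ⟨
        4 * (∑[ a < suc n ] ∑[ b < suc n ] D (toℕ a) (toℕ b))
          ≡⟨ cong (λ N → 4 * (∑[ a < N ] ∑[ b < N ] belowCarryFree N (toℕ a) (toℕ b))) 1+n≡s*p ⟩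
        4 * (∑[ a < s * p ] ∑[ b < s * p ] belowCarryFree (s * p) (toℕ a) (toℕ b))
          ≡⟨ cong (4 *_) (∑-belowCarryFree s) ⟩
        4 * (triangle s * triangle p)        ≡⟨ double (triangle s) (triangle p) ⟩
        (2 * triangle s) * (2 * triangle p)  ≡⟨ cong₂ _*_ (2*triangle s) (2*triangle p) ⟩
        (s * suc s) * (p * suc p)            ∎
        where
        open ≡-Reasoning
        regroup : ∀ r m → 4 * r + 12 * suc m ≡ 4 * (suc (suc m) + (suc m + (r + m)))
        regroup = solve-∀
        double : ∀ a b → 4 * (a * b) ≡ (2 * a) * (2 * b)
        double = solve-∀

-- From the count to the rational rank formula.

module RankFormula where
  open import Data.Integer.Base using (ℤ; +_)
  open import Data.Rational.Base using (_/_)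

  fromℚᵘ-homo-+ : ∀ u v → fromℚᵘ (u ℚᵘ.+ v) ≡ fromℚᵘ u ℚ.+ fromℚᵘ v
  fromℚᵘ-homo-+ u v = ℚₚ.toℚᵘ-injective (begin
    ℚ.toℚᵘ (fromℚᵘ (u ℚᵘ.+ v))                ≈⟨ ℚₚ.toℚᵘ-fromℚᵘ (u ℚᵘ.+ v) ⟩
    u ℚᵘ.+ v                                  ≈⟨ ℚᵘₚ.+-cong (ℚₚ.toℚᵘ-fromℚᵘ u) (ℚₚ.toℚᵘ-fromℚᵘ v) ⟨
    ℚ.toℚᵘ (fromℚᵘ u) ℚᵘ.+ ℚ.toℚᵘ (fromℚᵘ v)  ≈⟨ ℚₚ.toℚᵘ-homo-+ (fromℚᵘ u) (fromℚᵘ v) ⟨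
    ℚ.toℚᵘ (fromℚᵘ u ℚ.+ fromℚᵘ v)            ∎)
    where open ℚᵘₚ.≃-Reasoning

  -- Cross-multiplication in the unnormalised rationals reduces an equality in ℚ to an integer
  -- identity within reach of the ring solver.
  integer≡fraction : ∀ i j d → i Int.* + suc d ≡ j → i / 1 ≡ j / suc d
  integer≡fraction i j d eq =
    ℚₚ.fromℚᵘ-cong {mkℚᵘ i 0} {mkℚᵘ j d} (*≡* (≡.trans eq (≡.sym (ℤₚ.*-identityʳ j))))

  integer≡sum : ∀ i j d k e → i Int.* + (suc d ℕ.* suc e) ≡ j Int.* + suc e Int.+ k Int.* + suc d →
    i / 1 ≡ j / suc d ℚ.+ k / suc e
  integer≡sum i j d k e eq = ≡.trans
    (ℚₚ.fromℚᵘ-cong {mkℚᵘ i 0} {mkℚᵘ j d ℚᵘ.+ mkℚᵘ k e} (*≡* (≡.trans eq (≡.sym (ℤₚ.*-identityʳ _)))))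
    (fromℚᵘ-homo-+ (mkℚᵘ j d) (mkℚᵘ k e))

  module _ (P S R : ℤ) where
    open Int using (_+_; _*_; _-_)

    Count : Set
    Count = + 4 * R + + 12 * (S * P - + 1) ≡ S * (S + + 1) * (P * (P + + 1))

    count⇒ : Count → + 4 * R ≡ S * (S + + 1) * (P * (P + + 1)) - + 12 * (S * P - + 1)
    count⇒ h = ≡.trans (isolate (+ 4 * R) (+ 12 * (S * P - + 1))) (cong (_- + 12 * (S * P - + 1)) h)
      where
      isolate : ∀ i j → i ≡ i + j - j
      isolate = ℤSolver.solve-∀

  -- All four cases are values of the single expression s (s + 1) p (p + 1) / 4 - 3 (s p - 1). Since
  -- the count determines 4 r, a formula with denominator 2 leaves a factor 2 to cancel and one with
  -- denominator 1 a factor 4.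
  rankFormula≡ : ∀ p s r → 1 ≤ s → Count (+ p) (+ s) (+ r) → + r / 1 ≡ rankFormula p s
  rankFormula≡ p 1 r _ h = integer≡fraction (+ r) _ 1
    (ℤₚ.*-cancelˡ-≡ (+ 2) _ _ (≡.trans (lhs (+ r)) (≡.trans (count⇒ (+ p) (+ 1) (+ r) h) (rhs (+ p)))))
    where
    open Int using (_+_; _*_; _-_)
    lhs : ∀ R → + 2 * (R * + 2) ≡ + 4 * R
    lhs = ℤSolver.solve-∀
    rhs : ∀ P → + 1 * (+ 1 + + 1) * (P * (P + + 1)) - + 12 * (+ 1 * P - + 1) ≡ + 2 * ((P - + 2) * (P - + 3))
    rhs = ℤSolver.solve-∀
  rankFormula≡ p 2 r _ h = integer≡sum (+ r) ((+ p - + 2) * (+ p - + 3)) 1 (+ p * (+ p - + 2)) 0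
    (ℤₚ.*-cancelˡ-≡ (+ 2) _ _ (≡.trans (lhs (+ r)) (≡.trans (count⇒ (+ p) (+ 2) (+ r) h) (rhs (+ p)))))
    where
    open Int using (_+_; _*_; _-_)
    lhs : ∀ R → + 2 * (R * + 2) ≡ + 4 * R
    lhs = ℤSolver.solve-∀
    rhs : ∀ P → + 2 * (+ 2 + + 1) * (P * (P + + 1)) - + 12 * (+ 2 * P - + 1) ≡
                + 2 * ((P - + 2) * (P - + 3) * + 1 + P * (P - + 2) * + 2)
    rhs = ℤSolver.solve-∀
  rankFormula≡ p 3 r _ h = integer≡fraction (+ r) _ 0
    (ℤₚ.*-cancelˡ-≡ (+ 4) _ _ (≡.trans (lhs (+ r)) (≡.trans (count⇒ (+ p) (+ 3) (+ r) h) (rhs (+ p)))))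
    where
    open Int using (_+_; _*_; _-_)
    lhs : ∀ R → + 4 * (R * + 1) ≡ + 4 * R
    lhs = ℤSolver.solve-∀
    rhs : ∀ P → + 3 * (+ 3 + + 1) * (P * (P + + 1)) - + 12 * (+ 3 * P - + 1) ≡
                + 4 * (+ 3 * ((P - + 1) * (P - + 1)))
    rhs = ℤSolver.solve-∀
  rankFormula≡ p s@(suc (suc (suc (suc _)))) r _ h =
    integer≡sum (+ r) (+ 3 * ((+ p - + 1) * (+ p - + 1))) 0
      (+ p * ((+ p + + 1) * (+ s * + s) + (+ p - + 11) * + s - + 12 * (+ p - + 2))) 3
      (≡.trans (ℤₚ.*-comm (+ r) (+ 4)) (≡.trans (count⇒ (+ p) (+ s) (+ r) h) (rhs (+ p) (+ s))))
    where
    open Int using (_+_; _*_; _-_)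
    rhs : ∀ P S → S * (S + + 1) * (P * (P + + 1)) - + 12 * (S * P - + 1) ≡
                  + 3 * ((P - + 1) * (P - + 1)) * + 4 +
                  P * ((P + + 1) * (S * S) + (P - + 11) * S - + 12 * (P - + 2)) * + 1
    rhs = ℤSolver.solve-∀

  count : ∀ p s n r → suc n ≡ s ℕ.* p →
    4 ℕ.* r ℕ.+ 12 ℕ.* n ≡ (s ℕ.* suc s) ℕ.* (p ℕ.* suc p) → Count (+ p) (+ s) (+ r)
  count p s n r 1+n≡s*p h = begin
    + 4 * + r + + 12 * (+ s * + p - + 1)     ≡⟨ cong (λ m → + 4 * + r + + 12 * (m - + 1)) (≡.trans (≡.sym (ℤₚ.pos-* s p)) (cong +_ (≡.sym 1+n≡s*p))) ⟩
    + 4 * + r + + 12 * (+ suc n - + 1)       ≡⟨⟩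
    + 4 * + r + + 12 * + n                   ≡⟨ cong₂ _+_ (ℤₚ.pos-* 4 r) (ℤₚ.pos-* 12 n) ⟨
    + (4 ℕ.* r ℕ.+ 12 ℕ.* n)                 ≡⟨ cong +_ h ⟩
    + ((s ℕ.* suc s) ℕ.* (p ℕ.* suc p))      ≡⟨ ℤₚ.pos-* (s ℕ.* suc s) (p ℕ.* suc p) ⟩
    + (s ℕ.* suc s) * + (p ℕ.* suc p)        ≡⟨ cong₂ _*_ (pronic s) (pronic p) ⟩
    + s * (+ s + + 1) * (+ p * (+ p + + 1))  ∎
    where
    open Int using (_+_; _*_; _-_)
    open ≡-Reasoning
    pronic : ∀ m → + (m ℕ.* suc m) ≡ + m * (+ m + + 1)
    pronic m = ≡.trans (ℤₚ.pos-* m (suc m)) (cong (λ k → + m * + k) (ℕₚ.+-comm 1 m))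

-- Positions and entries of lists.

lookup-injective : ∀ {a} {A : Set a} {xs : List A} → Unique xs → ∀ i j → lookup xs i ≡ lookup xs j → i ≡ j
lookup-injective (_ ∷ _)   zero    zero    _  = ≡.refl
lookup-injective (x∉ ∷ _)  zero    (suc j) eq = contradiction eq (All.lookup x∉ (∈-lookup j))
lookup-injective (x∉ ∷ _)  (suc i) zero    eq = contradiction (≡.sym eq) (All.lookup x∉ (∈-lookup i))
lookup-injective (_ ∷ xs!) (suc i) (suc j) eq = cong suc (lookup-injective xs! i j eq)

length-filter-tabulate : ∀ {a b p} {A : Set a} {B : Set b} {P : Pred B p} (P? : Decidable P) (f : A → B)
  {n} (g : Fin n → A) → length (filter (λ x → P? (f x)) (tabulate g)) ≡ length (filter P? (tabulate (f ∘ g)))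
length-filter-tabulate P? f {zero}  g = ≡.refl
length-filter-tabulate P? f {suc n} g with P? (f (g zero))
... | yes _ = cong suc (length-filter-tabulate P? f (g ∘ suc))
... | no _  = length-filter-tabulate P? f (g ∘ suc)

-- The rank counts positions of columns, whereas the combinatorial count is over the exponent pairs
-- themselves.
length-filter-lookup : ∀ {a p} {A : Set a} {P : Pred A p} (P? : Decidable P) (xs : List A) →
  length (filter (λ i → P? (lookup xs i)) (allFin (length xs))) ≡ length (filter P? xs)
length-filter-lookup P? xs =
  ≡.trans (length-filter-tabulate P? (lookup xs) id) (cong (length ∘ filter P?) (Listₚ.tabulate-lookup xs))

-- Fields of characteristic p and the rank of monomial matrices.

module FieldProperties {c ℓ} (K : Field c ℓ) where
  open Field K
  open SetoidReasoning setoid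
  open Exp commutativeSemiring using (^-congˡ; ^-congʳ; ^-homo-*; ^-assocʳ; ^-distrib-*) public
  open Mult semiring using (×1-homo-*; ×-homo-1; ×-congˡ; ×-assoc-*; ×-congʳ) public
  open SemiringSum semiring using (sum-cong-≋; *-distribˡ-sum; *-distribʳ-sum; ∑-distrib-+; sum-permute) public

  ∑-zero : ∀ {n} (t : Vector Carrier n) → (∀ k → t k ≈ 0#) → sum t ≈ 0#
  ∑-zero = sum-zero +-commutativeMonoid

  ∑-select : ∀ {n} (t : Vector Carrier n) i → (∀ k → k ≢ i → t k ≈ 0#) → sum t ≈ t i
  ∑-select = sum-select +-commutativeMonoid

  *-cancelʳ-nonZero : ∀ {a b d} → ¬ (d ≈ 0#) → a * d ≈ b * d → a ≈ b
  *-cancelʳ-nonZero {a} {b} {d} d≉0 ad≈bd = begin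
    a             ≈⟨ recover a ⟨
    a * d * d ⁻¹  ≈⟨ *-congʳ ad≈bd ⟩
    b * d * d ⁻¹  ≈⟨ recover b ⟩
    b             ∎
    where
    recover : ∀ e → e * d * d ⁻¹ ≈ e
    recover e = trans (*-assoc e d (d ⁻¹)) (trans (*-congˡ (⁻¹-right d d≉0)) (*-identityʳ e))

  *-nonZero : ∀ {a b} → ¬ (a ≈ 0#) → ¬ (b ≈ 0#) → ¬ (a * b ≈ 0#)
  *-nonZero {a} {b} a≉0 b≉0 ab≈0 = a≉0 (*-cancelʳ-nonZero b≉0 (trans ab≈0 (sym (zeroˡ b))))

  ^-nonZero : ∀ {a} n → ¬ (a ≈ 0#) → ¬ (a ^ n ≈ 0#)
  ^-nonZero zero    _   = 1≉0
  ^-nonZero (suc n) a≉0 = *-nonZero a≉0 (^-nonZero n a≉0)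

  0^n≈0 : ∀ n .{{_ : ℕ.NonZero n}} → 0# ^ n ≈ 0#
  0^n≈0 (suc n) = zeroˡ _

  1^n≈1 : ∀ n → 1# ^ n ≈ 1#
  1^n≈1 zero    = refl
  1^n≈1 (suc n) = trans (*-identityˡ _) (1^n≈1 n)

  ⁻¹-nonZero : ∀ {a} → ¬ (a ≈ 0#) → ¬ (a ⁻¹ ≈ 0#)
  ⁻¹-nonZero {a} a≉0 a⁻¹≈0 = 1≉0 (trans (sym (⁻¹-right a a≉0)) (trans (*-congˡ a⁻¹≈0) (zeroʳ a)))

  -1≉0 : ¬ (- 1# ≈ 0#)
  -1≉0 -1≈0 = 1≉0 (trans (sym (+-identityʳ 1#)) (trans (+-congˡ (sym -1≈0)) (-‿inverseʳ 1#)))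

  δ : ∀ {n} → Fin n → Vector Carrier n
  δ i j = if does (i Finₚ.≟ j) then 1# else 0#

  δ-diagonal : ∀ {n} (i : Fin n) → δ i i ≈ 1#
  δ-diagonal i with i Finₚ.≟ i
  ... | yes _  = refl
  ... | no i≢i = contradiction ≡.refl i≢i

  δ-off-diagonal : ∀ {n} {i j : Fin n} → j ≢ i → δ i j ≈ 0#
  δ-off-diagonal {i = i} {j} j≢i with i Finₚ.≟ j
  ... | yes i≡j = contradiction (≡.sym i≡j) j≢i
  ... | no _    = refl

  ∑-δ : ∀ {n} i (t : Vector Carrier n) → sum (λ j → δ i j * t j) ≈ t i
  ∑-δ i t = trans
    (∑-select (λ j → δ i j * t j) i λ j j≢i → trans (*-congʳ (δ-off-diagonal j≢i)) (zeroˡ (t j)))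
    (trans (*-congʳ (δ-diagonal i)) (*-identityˡ (t i)))

  -- The binomial theorem, padded with the vanishing coefficients beyond m, so that h runs over p
  -- values like the index of the expansion that defines the Cartier operator.
  [1+x]^m≈∑ : ∀ {m p} → m < p → ∀ x → (1# + x) ^ m ≈ sum {p} λ h → (m choose toℕ h) · x ^ toℕ h
  [1+x]^m≈∑ {m} m<p x with o , ≡.refl ← ℕₚ.m≤n⇒∃[o]m+o≡n m<p = begin
    (1# + x) ^ m  ≈⟨ ^-congˡ m (+-comm 1# x) ⟩
    (x + 1#) ^ m  ≈⟨ Binomial.theorem commutativeSemiring m x 1# ⟩
    sum {suc m} (λ k → (m choose toℕ k) · (x ^ toℕ k * 1# ^ (m ∸ toℕ k)))
      ≈⟨ sum-cong-≋ {suc m} (λ k → ×-congʳ (m choose toℕ k) (trans (*-congˡ (1^n≈1 (m ∸ toℕ k))) (*-identityʳ (x ^ toℕ k)))) ⟩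
    sum {suc m} (term ∘ toℕ)                                ≈⟨ +-identityʳ _ ⟨
    sum {suc m} (term ∘ toℕ) + 0#
      ≈⟨ +-congˡ (∑-zero {o} (λ k → term (suc m ℕ.+ toℕ k)) λ k →
           ×-congˡ (k>n⇒nCk≡0 (ℕₚ.m≤m+n (suc m) (toℕ k)))) ⟨
    sum {suc m} (term ∘ toℕ) + sum {o} (λ k → term (suc m ℕ.+ toℕ k))
      ≈⟨ sum-split +-commutativeMonoid (suc m) o term ⟨
    sum {suc m ℕ.+ o} (term ∘ toℕ)                          ∎
    where
    term : ℕ → Carrier
    term h = (m choose h) · x ^ h

  module _ {p} (char : HasCharacteristic K p) where

    characteristic∤1 : ¬ (p ∣ 1)
    characteristic∤1 p∣1 = 1≉0 (trans (sym (×-homo-1 1#)) (Equivalence.from (char 1) p∣1))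

    ·1-nonZero : ∀ {m} → ¬ (p ∣ m) → ¬ (m · 1# ≈ 0#)
    ·1-nonZero {m} p∤m = p∤m ∘ Equivalence.to (char m)

    factorial-nonZero : ∀ {m} → m < p → ¬ ((m !) · 1# ≈ 0#)
    factorial-nonZero {zero}  _     eq = 1≉0 (trans (sym (×-homo-1 1#)) eq)
    factorial-nonZero {suc m} 1+m<p eq = *-nonZero
      (·1-nonZero λ p∣1+m → ℕₚ.<⇒≱ 1+m<p (∣⇒≤ p∣1+m))
      (factorial-nonZero (ℕₚ.<⇒≤ 1+m<p))
      (trans (sym (×1-homo-* (suc m) (m !))) eq)

    -- The binomial coefficient divides m!, whose factors are positive and below p, hence nonzero in
    -- K.
    binomial-nonZero : ∀ {m k} → m < p → k ≤ m → ¬ ((m choose k) · 1# ≈ 0#)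
    binomial-nonZero {m} {k} m<p k≤m eq = factorial-nonZero m<p (begin
      (m !) · 1#                                      ≈⟨ ×-congˡ m!≡ ⟩
      ((m choose k) ℕ.* (k ! ℕ.* (m ∸ k) !)) · 1#     ≈⟨ ×1-homo-* (m choose k) _ ⟩
      (m choose k) · 1# * ((k ! ℕ.* (m ∸ k) !) · 1#)  ≈⟨ *-congʳ eq ⟩
      0# * ((k ! ℕ.* (m ∸ k) !) · 1#)                 ≈⟨ zeroˡ _ ⟩
      0#                                              ∎)
      where
      instance _ = k ℕₚ.!* (m ∸ k) !≢0
      m!≡ : m ! ≡ (m choose k) ℕ.* (k ! ℕ.* (m ∸ k) !)
      m!≡ = ≡.trans (≡.sym (DivMod.m/n*n≡m (k![n∸k]!∣n! k≤m)))
                    (cong (ℕ._* (k ! ℕ.* (m ∸ k) !)) (≡.sym (nCk≡n!/k![n-k]! k≤m)))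

  -- A root of the polynomial Z^p - a. It serves to write the constants of an expansion as p-th
  -- powers.
  algebraicallyClosed⇒root : IsAlgebraicallyClosed K → ∀ p .{{_ : ℕ.NonZero p}} a → ∃[ z ] z ^ p ≈ a
  algebraicallyClosed⇒root closed (suc d) a = let z , root = closed d coefficients in z , (begin
    z ^ suc d                                               ≈⟨ +-identityʳ _ ⟨
    z ^ suc d + 0#                                          ≈⟨ +-congˡ (-‿inverseˡ a) ⟨
    z ^ suc d + (- a + a)                                   ≈⟨ +-assoc _ _ _ ⟨
    z ^ suc d + - a + a                                     ≈⟨ +-congʳ (+-congˡ (constant z)) ⟨
    z ^ suc d + sum (λ k → coefficients k * z ^ toℕ k) + a  ≈⟨ +-congʳ root ⟩
    0# + a                                                  ≈⟨ +-identityˡ a ⟩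
    a                                                       ∎)
    where
    coefficients : Vector Carrier (suc d)
    coefficients zero    = - a
    coefficients (suc _) = 0#
    constant : ∀ z → sum (λ k → coefficients k * z ^ toℕ k) ≈ - a
    constant z = trans (+-cong (*-identityʳ (- a)) (∑-zero {d} _ λ k → zeroˡ (z ^ suc (toℕ k)))) (+-identityʳ (- a))

  -- The columns in `P` are themselves a basis of the column space: as their pivots lie in distinct
  -- rows, the pivot row of a column isolates its coefficient in any vanishing combination. The
  -- decidable `P` tells which columns are nonzero, since equality in K need not be decidable.
  monomial-rank : ∀ {m n q} (M : Matrix K m n) {P : Pred (Fin n) q} (P? : Decidable P)
    (σ : ∀ {j} → P j → Fin m) →
    (∀ {j k} (u : P j) (v : P k) → σ u ≡ σ v → j ≡ k) →
    (∀ {j} (u : P j) → ¬ (M (σ u) j ≈ 0#)) →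
    (∀ {j} (u : P j) i → i ≢ σ u → M i j ≈ 0#) →
    (∀ {j} → ¬ P j → ∀ i → M i j ≈ 0#) →
    HasRank K M (length (filter P? (allFin n)))
  monomial-rank {n = n} M {P} P? σ σ-injective pivot off-pivot zero-column =
    (λ k i → M i (col k)) , independent , (λ k → column-inSpan (col k)) , spanning
    where
    pivots : List (Fin n)
    pivots = filter P? (allFin n)

    col : Fin (length pivots) → Fin n
    col = lookup pivots

    col∈P : ∀ k → P (col k)
    col∈P k = All.lookup (all-filter P? (allFin n)) (∈-lookup k)

    col-injective : ∀ j k → col j ≡ col k → j ≡ k
    col-injective = lookup-injective (Uniqueₚ.filter⁺ P? (Uniqueₚ.allFin⁺ n))

    independent : LinearlyIndependent K λ k i → M i (col k)
    independent a eq k = *-cancelʳ-nonZero (pivot (col∈P k)) (begin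
      a k * M i (col k)              ≈⟨ ∑-select (λ j → a j * M i (col j)) k other ⟨
      sum (λ j → a j * M i (col j))  ≈⟨ eq i ⟩
      0#                             ≈⟨ zeroˡ _ ⟨
      0# * M i (col k)               ∎)
      where
      i = σ (col∈P k)
      other : ∀ j → j ≢ k → a j * M i (col j) ≈ 0#
      other j j≢k = trans (*-congˡ (off-pivot (col∈P j) i λ σk≡σj →
        j≢k (col-injective j k (≡.sym (σ-injective (col∈P k) (col∈P j) σk≡σj))))) (zeroʳ _)

    column-inSpan : ∀ j → InSpan K (λ j i → M i j) λ i → M i j
    column-inSpan j = δ j , λ i → sym (∑-δ j (M i))

    spanning : ∀ j → InSpan K (λ k i → M i (col k)) λ i → M i j
    spanning j with P? j
    ... | no ¬u = (λ _ → 0#) , λ i → trans (zero-column ¬u i) (sym (∑-zero {length pivots} _ λ k → zeroˡ (M i (col k))))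
    ... | yes u = δ k , λ i →
      trans (reflexive (cong (M i) (lookup-index j∈))) (sym (∑-δ k λ k → M i (col k)))
      where
      j∈ = ∈-filter⁺ P? (∈-allFin j) u
      k = index j∈

-- Polynomials in two variables and divisibility by the Fermat polynomial.

≡ᵇ-refl : ∀ m → (m ≡ᵇ m) ≡ true
≡ᵇ-refl zero    = ≡.refl
≡ᵇ-refl (suc m) = ≡ᵇ-refl m

≢⇒≡ᵇ-false : ∀ {m n} → m ≢ n → (m ≡ᵇ n) ≡ false
≢⇒≡ᵇ-false {m} {n} m≢n = Boolₚ.¬-not λ eq → m≢n (ℕₚ.≡ᵇ⇒≡ m n (subst T (≡.sym eq) _))

+-cancelˡ-≡ᵇ : ∀ k m n → (k ℕ.+ m ≡ᵇ k ℕ.+ n) ≡ (m ≡ᵇ n)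
+-cancelˡ-≡ᵇ zero    m n = ≡.refl
+-cancelˡ-≡ᵇ (suc k) m n = +-cancelˡ-≡ᵇ k m n

module PolynomialProperties {c ℓ} (K : Field c ℓ) where
  open Field K
  open FieldProperties K
  open SetoidReasoning setoid

  coefficient-++ : ∀ P Q i j → coefficient K (P ++ Q) i j ≈ coefficient K P i j + coefficient K Q i j
  coefficient-++ []      Q i j = sym (+-identityˡ _)
  coefficient-++ (_ ∷ P) Q i j = trans (+-congˡ (coefficient-++ P Q i j)) (sym (+-assoc _ _ _))

  -- A product of term lists unfolds to the concatenation of these, one for each term of the left
  -- factor.
  monomial* : Carrier × ℕ × ℕ → Polynomial K → Polynomial K
  monomial* (a , k , l) = map λ (b , k′ , l′) → a * b , k ℕ.+ k′ , l ℕ.+ l′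

  if-* : ∀ b x y → (if b then x * y else 0#) ≈ x * (if b then y else 0#)
  if-* true  x y = refl
  if-* false x y = sym (zeroʳ x)

  coefficient-monomial*-shift : ∀ a k l Q i j →
    coefficient K (monomial* (a , k , l) Q) (k ℕ.+ i) (l ℕ.+ j) ≈ a * coefficient K Q i j
  coefficient-monomial*-shift a k l []                  i j = sym (zeroʳ a)
  coefficient-monomial*-shift a k l ((b , k′ , l′) ∷ Q) i j
    rewrite +-cancelˡ-≡ᵇ k k′ i | +-cancelˡ-≡ᵇ l l′ j =
    trans (+-cong (if-* ((k′ ≡ᵇ i) ∧ (l′ ≡ᵇ j)) a b) (coefficient-monomial*-shift a k l Q i j))
          (sym (distribˡ a _ _))

  coefficient-monomial*-outside : ∀ a k l Q {i j} →
    (∀ k′ l′ → ((k ℕ.+ k′ ≡ᵇ i) ∧ (l ℕ.+ l′ ≡ᵇ j)) ≡ false) →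
    coefficient K (monomial* (a , k , l) Q) i j ≈ 0#
  coefficient-monomial*-outside a k l []                  outside = refl
  coefficient-monomial*-outside a k l ((b , k′ , l′) ∷ Q) outside rewrite outside k′ l′ =
    trans (+-identityˡ _) (coefficient-monomial*-outside a k l Q outside)

  -- Quantifying over i′ with k + i′ = i, instead of subtracting, makes the hypothesis vacuous for
  -- exponents outside the shifted support.
  coefficient-monomial*-zero : ∀ a k l Q i j →
    (∀ i′ j′ → k ℕ.+ i′ ≡ i → l ℕ.+ j′ ≡ j → coefficient K Q i′ j′ ≈ 0#) →
    coefficient K (monomial* (a , k , l) Q) i j ≈ 0#
  coefficient-monomial*-zero a k l Q i j Q≈0 with k ℕₚ.≤? i | l ℕₚ.≤? j
  ... | no k≰i | _ = coefficient-monomial*-outside a k l Q λ k′ l′ →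
    cong (_∧ (l ℕ.+ l′ ≡ᵇ j)) (≢⇒≡ᵇ-false λ eq → k≰i (subst (k ≤_) eq (ℕₚ.m≤m+n k k′)))
  ... | yes _ | no l≰j = coefficient-monomial*-outside a k l Q λ k′ l′ →
    ≡.trans (cong ((k ℕ.+ k′ ≡ᵇ i) ∧_) (≢⇒≡ᵇ-false λ eq → l≰j (subst (l ≤_) eq (ℕₚ.m≤m+n l l′))))
            (Boolₚ.∧-zeroʳ _)
  ... | yes k≤i | yes l≤j with ℕₚ.m≤n⇒∃[o]m+o≡n k≤i | ℕₚ.m≤n⇒∃[o]m+o≡n l≤j
  ...   | i′ , ≡.refl | j′ , ≡.refl =
    trans (coefficient-monomial*-shift a k l Q i′ j′) (trans (*-congˡ (Q≈0 i′ j′ ≡.refl ≡.refl)) (zeroʳ a))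

  -- A strict bound over all listed terms, zero coefficients included: the exact degree would
  -- require deciding equality in K. It starts the descending induction on the X-exponent in
  -- `fermat∣⇒≈0`.
  xDegreeBound : Polynomial K → ℕ
  xDegreeBound []                = 0
  xDegreeBound ((_ , k , _) ∷ P) = suc k ⊔ xDegreeBound P

  coefficient-beyond-bound : ∀ P i j → xDegreeBound P ≤ i → coefficient K P i j ≈ 0#
  coefficient-beyond-bound []                i j _     = refl
  coefficient-beyond-bound ((a , k , l) ∷ P) i j bound
    rewrite ≢⇒≡ᵇ-false (ℕₚ.<⇒≢ (ℕₚ.m⊔n≤o⇒m≤o (suc k) (xDegreeBound P) bound)) =
    trans (+-identityˡ _) (coefficient-beyond-bound P i j (ℕₚ.m⊔n≤o⇒n≤o (suc k) (xDegreeBound P) bound))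

  coefficient-tabulate : ∀ {r} (a : Vector Carrier r) (e : Fin r → ℕ × ℕ) i j →
    coefficient K (tabulate λ k → a k , e k) i j ≈
    sum λ k → if (proj₁ (e k) ≡ᵇ i) ∧ (proj₂ (e k) ≡ᵇ j) then a k else 0#
  coefficient-tabulate {zero}  a e i j = refl
  coefficient-tabulate {suc r} a e i j = +-congˡ (coefficient-tabulate (a ∘ suc) (e ∘ suc) i j)

  coefficient-at-exponent : ∀ {r} (a : Vector Carrier r) (e : Fin r → ℕ × ℕ) →
    (∀ k l → e k ≡ e l → k ≡ l) → ∀ k →
    coefficient K (tabulate λ k → a k , e k) (proj₁ (e k)) (proj₂ (e k)) ≈ a k
  coefficient-at-exponent a e e-injective k =
    trans (coefficient-tabulate a e _ _) (trans (∑-select _ k off) on)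
    where
    on : (if (proj₁ (e k) ≡ᵇ proj₁ (e k)) ∧ (proj₂ (e k) ≡ᵇ proj₂ (e k)) then a k else 0#) ≈ a k
    on rewrite ≡ᵇ-refl (proj₁ (e k)) | ≡ᵇ-refl (proj₂ (e k)) = refl
    off : ∀ l → l ≢ k → (if (proj₁ (e l) ≡ᵇ proj₁ (e k)) ∧ (proj₂ (e l) ≡ᵇ proj₂ (e k)) then a l else 0#) ≈ 0#
    off l l≢k with proj₁ (e l) ℕₚ.≟ proj₁ (e k) | proj₂ (e l) ℕₚ.≟ proj₂ (e k)
    ... | yes p | yes q = contradiction (e-injective l k (cong₂ _,_ p q)) l≢k
    ... | no p  | _     rewrite ≢⇒≡ᵇ-false p = refl
    ... | yes _ | no q  rewrite ≢⇒≡ᵇ-false q | Boolₚ.∧-zeroʳ (proj₁ (e l) ≡ᵇ proj₁ (e k)) = refl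

  coefficient-fermat* : ∀ n Q i j → coefficient K (_*ₚ_ K (fermat K n) Q) i j ≈
    coefficient K (monomial* (1# , n , 0) Q) i j +
    (coefficient K (monomial* (1# , 0 , n) Q) i j + coefficient K (monomial* (1# , 0 , 0) Q) i j)
  coefficient-fermat* n Q i j =
    trans (coefficient-++ (monomial* (1# , n , 0) Q) _ i j) (+-congˡ
      (trans (coefficient-++ (monomial* (1# , 0 , n) Q) _ i j) (+-congˡ
        (trans (coefficient-++ (monomial* (1# , 0 , 0) Q) [] i j) (+-identityʳ _)))))

  -- The coefficient of Q at Xⁱ Yʲ occurs in that of (Xⁿ + Yⁿ + 1) Q at Xⁿ⁺ⁱ Yʲ,
  -- whose other terms are coefficients of Q with larger X-exponent.
  fermat∣⇒≈0 : ∀ n .{{_ : ℕ.NonZero n}} G → _∣ₚ_ K (fermat K n) G →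
    (∀ i j → n ≤ i → coefficient K G i j ≈ 0#) → ∀ i j → coefficient K G i j ≈ 0#
  fermat∣⇒≈0 n@(suc n-1) G (Q , fermat*Q≈G) G-small i j =
    trans (sym (fermat*Q≈G i j)) (trans (coefficient-fermat* n Q i j) (trans
      (+-cong (zero-factor n 0) (trans (+-cong (zero-factor 0 n) (zero-factor 0 0)) (+-identityˡ 0#)))
      (+-identityˡ 0#)))
    where
    Q-vanishes : ∀ d i j → xDegreeBound Q ≤ i ℕ.+ d → coefficient K Q i j ≈ 0#
    Q-vanishes zero    i j bound = coefficient-beyond-bound Q i j (subst (_ ≤_) (ℕₚ.+-identityʳ i) bound)
    Q-vanishes (suc d) i j bound = begin
      coefficient K Q i j                                ≈⟨ *-identityˡ _ ⟨
      1# * coefficient K Q i j                           ≈⟨ coefficient-monomial*-shift 1# n 0 Q i j ⟨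
      c₁                                                 ≈⟨ +-identityʳ c₁ ⟨
      c₁ + 0#                                            ≈⟨ +-congˡ (+-identityʳ 0#) ⟨
      c₁ + (0# + 0#)                                     ≈⟨ +-congˡ (+-cong c₂≈0 c₃≈0) ⟨
      c₁ + (c₂ + c₃)                                     ≈⟨ coefficient-fermat* n Q (n ℕ.+ i) j ⟨
      coefficient K (_*ₚ_ K (fermat K n) Q) (n ℕ.+ i) j  ≈⟨ fermat*Q≈G (n ℕ.+ i) j ⟩
      coefficient K G (n ℕ.+ i) j                        ≈⟨ G-small (n ℕ.+ i) j (ℕₚ.m≤m+n n i) ⟩
      0#                                                 ∎
      where
      c₁ = coefficient K (monomial* (1# , n , 0) Q) (n ℕ.+ i) j
      c₂ = coefficient K (monomial* (1# , 0 , n) Q) (n ℕ.+ i) j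
      c₃ = coefficient K (monomial* (1# , 0 , 0) Q) (n ℕ.+ i) j
      bound′ : xDegreeBound Q ≤ n ℕ.+ i ℕ.+ d
      bound′ = ℕₚ.≤-trans bound (ℕₚ.≤-trans (ℕₚ.≤-reflexive (ℕₚ.+-suc i d))
                 (s≤s (ℕₚ.+-monoˡ-≤ d (ℕₚ.m≤n+m i n-1))))
      c₂≈0 : c₂ ≈ 0#
      c₂≈0 = coefficient-monomial*-zero 1# 0 n Q _ _ λ { _ j′ ≡.refl _ → Q-vanishes d (n ℕ.+ i) j′ bound′ }
      c₃≈0 : c₃ ≈ 0#
      c₃≈0 = coefficient-monomial*-zero 1# 0 0 Q _ _ λ { _ j′ ≡.refl _ → Q-vanishes d (n ℕ.+ i) j′ bound′ }

    zero-factor : ∀ k l → coefficient K (monomial* (1# , k , l) Q) i j ≈ 0#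
    zero-factor k l = coefficient-monomial*-zero 1# k l Q i j λ i′ j′ _ _ →
      Q-vanishes (xDegreeBound Q) i′ j′ (ℕₚ.m≤n+m _ i′)

  -- Through `vanishes⇔` this becomes the equation of the curve in the function field.
  fermat∣fermat : ∀ n → _∣ₚ_ K (fermat K n) (fermat K n)
  fermat∣fermat n = (1# , 0 , 0) ∷ [] , λ i j → unit i j
    where
    unit : ∀ i j → coefficient K (_*ₚ_ K (fermat K n) ((1# , 0 , 0) ∷ [])) i j ≈ coefficient K (fermat K n) i j
    unit i j rewrite ℕₚ.+-identityʳ n = +-cong (1*1 _) (+-cong (1*1 _) (+-congʳ (1*1 _)))
      where
      1*1 : ∀ b → (if b then 1# * 1# else 0#) ≈ (if b then 1# else 0#)
      1*1 true  = *-identityˡ 1#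
      1*1 false = refl

-- The index set of the basis.

exponents-unique : ∀ n → Unique (exponents n)
exponents-unique n = Uniqueₚ.filter⁺ (λ (i , j) → i ℕ.+ j ℕ.+ 3 ℕₚ.≤? n)
  (Uniqueₚ.cartesianProduct⁺ (Uniqueₚ.upTo⁺ n) (Uniqueₚ.upTo⁺ n))

∈-exponents⁻ : ∀ {n i j} → (i , j) ∈ exponents n → i ℕ.+ j ℕ.+ 3 ≤ n
∈-exponents⁻ {n} ij∈ = proj₂ (∈-filter⁻ (λ (i , j) → i ℕ.+ j ℕ.+ 3 ℕₚ.≤? n) {xs = cartesianProduct (upTo n) (upTo n)} ij∈)

∈-exponents⁺ : ∀ {n i j} → i ℕ.+ j ℕ.+ 3 ≤ n → (i , j) ∈ exponents n
∈-exponents⁺ {n} {i} {j} i+j+3≤n = ∈-filter⁺ (λ (i , j) → i ℕ.+ j ℕ.+ 3 ℕₚ.≤? n)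
  (∈-cartesianProduct⁺ (∈-upTo⁺ (below (ℕₚ.m≤m+n i j))) (∈-upTo⁺ (below (ℕₚ.m≤n+m j i)))) i+j+3≤n
  where
  below : ∀ {k} → k ≤ i ℕ.+ j → k < n
  below k≤i+j = ℕₚ.≤-trans (s≤s k≤i+j)
    (ℕₚ.≤-trans (ℕₚ.m≤n+m (suc (i ℕ.+ j)) 2) (ℕₚ.≤-trans (ℕₚ.≤-reflexive (ℕₚ.+-comm 3 (i ℕ.+ j))) i+j+3≤n))

-- The function field of the Fermat curve.

module FermatProperties {c ℓ} {K : Field c ℓ} {n : ℕ} .{{n≢0 : ℕ.NonZero n}} {c′ ℓ′}
                        (FF : FermatFunctionField K n c′ ℓ′) where
  private module K = Field K
  open FermatFunctionField FF
  open FieldProperties functionField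
  open PolynomialProperties K
  open SetoidReasoning setoid
  open IsRingHomomorphism ι-hom public using ()
    renaming (⟦⟧-cong to ι-cong; +-homo to ι-+; *-homo to ι-*; -‿homo to ι-neg; 0#-homo to ι-0; 1#-homo to ι-1)

  eval : Polynomial K → Carrier
  eval = evaluate K functionField ι x y

  ι-^ : ∀ a k → ι (a K.^ k) ≈ ι a ^ k
  ι-^ a zero    = ι-1
  ι-^ a (suc k) = trans (ι-* a (a K.^ k)) (*-congˡ (ι-^ a k))

  ι-·1 : ∀ m → ι (m K.· K.1#) ≈ m · 1#
  ι-·1 zero    = ι-0
  ι-·1 (suc m) = trans (ι-+ K.1# (m K.· K.1#)) (+-cong ι-1 (ι-·1 m))

  -- Polynomials of X-degree below n are normal forms modulo the Fermat polynomial, which is monic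
  -- in X of degree n.
  eval≈0⇒≈0 : ∀ G → (∀ i j → n ≤ i → coefficient K G i j K.≈ K.0#) → eval G ≈ 0# →
    ∀ i j → coefficient K G i j K.≈ K.0#
  eval≈0⇒≈0 G G-small G≈0 = fermat∣⇒≈0 n G (Equivalence.to (vanishes⇔ G) G≈0) G-small

  ι-nonZero : ∀ {a} → ¬ (a K.≈ K.0#) → ¬ (ι a ≈ 0#)
  ι-nonZero {a} a≉0 ιa≈0 = 1≉0 (begin
    1#                ≈⟨ ι-1 ⟨
    ι K.1#            ≈⟨ ι-cong (K.⁻¹-right a a≉0) ⟨
    ι (a K.* a K.⁻¹)  ≈⟨ ι-* a (a K.⁻¹) ⟩
    ι a * ι (a K.⁻¹)  ≈⟨ *-congʳ ιa≈0 ⟩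
    0# * ι (a K.⁻¹)   ≈⟨ zeroˡ _ ⟩
    0#                ∎)

  eval-tabulate : ∀ {r} (a : Vector K.Carrier r) (e : Fin r → ℕ × ℕ) →
    eval (tabulate λ k → a k , e k) ≈ sum λ k → ι (a k) * x ^ proj₁ (e k) * y ^ proj₂ (e k)
  eval-tabulate {zero}  a e = refl
  eval-tabulate {suc r} a e = +-congˡ (eval-tabulate (a ∘ suc) (e ∘ suc))

  monomials-independent : ∀ {r} (a : Vector K.Carrier r) (e : Fin r → ℕ × ℕ) →
    (∀ k l → e k ≡ e l → k ≡ l) → (∀ k → proj₁ (e k) < n) →
    sum (λ k → ι (a k) * x ^ proj₁ (e k) * y ^ proj₂ (e k)) ≈ 0# → ∀ k → a k K.≈ K.0#
  monomials-independent a e e-injective e<n ∑≈0 k =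
    K.trans (K.sym (coefficient-at-exponent a e e-injective k))
            (eval≈0⇒≈0 G G-small (trans (eval-tabulate a e) ∑≈0) _ _)
    where
    G = tabulate λ k → a k , e k
    G-small : ∀ i j → n ≤ i → coefficient K G i j K.≈ K.0#
    G-small i j n≤i = K.trans (coefficient-tabulate a e i j) (FieldProperties.∑-zero K _ term)
      where
      term : ∀ k → (if (proj₁ (e k) ≡ᵇ i) ∧ (proj₂ (e k) ≡ᵇ j) then a k else K.0#) K.≈ K.0#
      term k rewrite ≢⇒≡ᵇ-false (ℕₚ.<⇒≢ (ℕₚ.<-≤-trans (e<n k) n≤i)) = K.refl

  -- The monomial Y alone is an independent family, its X-exponent 0 being below n. Negative powers
  -- of y are thereby available.
  y≉0 : ¬ (y ≈ 0#)
  y≉0 y≈0 = K.1≉0 (monomials-independent (λ (_ : Fin 1) → K.1#) (λ _ → 0 , 1)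
    (λ { Fin.zero Fin.zero _ → ≡.refl }) (λ _ → ℕ.>-nonZero⁻¹ n)
    (trans (+-identityʳ _) (trans (*-congˡ (trans (*-identityʳ y) y≈0)) (zeroʳ _))) Fin.zero)

  yⁿ≈-[1+xⁿ] : y ^ n ≈ - 1# * (1# + x ^ n)
  yⁿ≈-[1+xⁿ] = begin
    y ^ n                                    ≈⟨ +-identityʳ _ ⟨
    y ^ n + 0#                               ≈⟨ +-congˡ (-‿inverseʳ (1# + x ^ n)) ⟨
    y ^ n + ((1# + x ^ n) + - (1# + x ^ n))  ≈⟨ +-assoc _ _ _ ⟨
    y ^ n + (1# + x ^ n) + - (1# + x ^ n)    ≈⟨ +-congʳ equation ⟩
    0# + - (1# + x ^ n)                      ≈⟨ +-identityˡ _ ⟩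
    - (1# + x ^ n)                           ≈⟨ -1*x≈-x _ ⟨
    - 1# * (1# + x ^ n)                      ∎
    where
    open import Algebra.Properties.Ring ring using (-1*x≈-x)
    equation : y ^ n + (1# + x ^ n) ≈ 0#
    equation = begin
      y ^ n + (1# + x ^ n)  ≈⟨ +-congˡ (+-comm 1# (x ^ n)) ⟩
      y ^ n + (x ^ n + 1#)  ≈⟨ +-assoc _ _ _ ⟨
      y ^ n + x ^ n + 1#    ≈⟨ +-congʳ (+-comm _ _) ⟩
      x ^ n + y ^ n + 1#    ≈⟨ +-assoc _ _ _ ⟩
      x ^ n + (y ^ n + 1#)  ≈⟨ +-cong (trans (*-identityʳ _) (trans (*-congʳ ι-1) (*-identityˡ _)))
                                     (+-cong (trans (*-congʳ ι1*1) (*-identityˡ _))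
                                       (trans (+-identityʳ _) (trans (*-identityʳ _) ι1*1))) ⟨
      eval (fermat K n)  ≈⟨ Equivalence.from (vanishes⇔ (fermat K n)) (fermat∣fermat n) ⟩
      0#                 ∎
      where
      ι1*1 : ι K.1# * 1# ≈ 1#
      ι1*1 = trans (*-identityʳ _) ι-1

-- The map that the Cartier operator induces on indices.

module DigitExchanges where
  open Counting
  open DivMod using (_/_; _%_)
  open import Data.Nat.Base using (_+_; _*_)

  suc[m]≡c*p⇒m/p≡pred[c] : ∀ {m} c p .{{_ : NonZero p}} → suc m ≡ c * p → m / p ≡ pred c
  suc[m]≡c*p⇒m/p≡pred[c] {m} (suc c) p@(suc _) eq = ℕₚ.≤-antisym
    (ℕ.s≤s⁻¹ (DivMod.m<n*o⇒m/o<n (ℕₚ.≤-reflexive eq)))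
    (subst (_≤ m / p) (DivMod.m*n/n≡m c p)
      (DivMod./-monoˡ-≤ p (subst (c * p ≤_) (≡.sym (ℕₚ.suc-injective eq)) (ℕₚ.m≤n+m (c * p) _))))

  module DigitExchange (p s n : ℕ) .{{_ : NonZero p}} .{{_ : NonZero s}} .{{_ : NonZero n}}
                       (1+n≡s*p : suc n ≡ s * p) where
    open Digits p

    exchange : ℕ → ℕ
    exchange a = a / p + s * (a % p)

    -- The image of xⁱ yʲ dx / yⁿ⁻¹ is a multiple of the form with exponents
    -- target i and target j.
    target : ℕ → ℕ
    target i = pred (exchange (suc i))

    -- Since n ≡ -1 modulo p, this is h ↦ i - h modulo p.
    reflect : ℕ → ℕ → ℕ
    reflect i h = (i + n * h) % p

    -- Modulo p this is i - (i - h) = h. In natural numbers, i + n (i + n h) = h + (n + 1) (i + (n -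
    -- 1) h), and n + 1 = s p.
    reflect-involutive : ∀ i {h} → h < p → reflect i (reflect i h) ≡ h
    reflect-involutive i {h} h<p = begin
      (i + n * r) % p                        ≡⟨ DivMod.[m+kn]%n≡m%n (i + n * r) (n * e) p ⟨
      (i + n * r + n * e * p) % p            ≡⟨ cong (_% p) (collect i n r e p) ⟩
      (i + n * (r + e * p)) % p              ≡⟨ cong (λ m → (i + n * m) % p) (DivMod.m≡m%n+[m/n]*n (i + n * h) p) ⟨
      (i + n * (i + n * h)) % p              ≡⟨ cong (λ n → (i + n * (i + n * h)) % p) (ℕₚ.suc-pred n) ⟨
      (i + suc n′ * (i + suc n′ * h)) % p    ≡⟨ cong (_% p) (expand i n′ h) ⟩
      (h + suc (suc n′) * (i + n′ * h)) % p  ≡⟨ cong (λ N → (h + N * (i + n′ * h)) % p) (≡.trans (cong suc (ℕₚ.suc-pred n)) 1+n≡s*p) ⟩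
      (h + s * p * (i + n′ * h)) % p         ≡⟨ cong (_% p) (regroup h s p (i + n′ * h)) ⟩
      (h + s * (i + n′ * h) * p) % p         ≡⟨ DivMod.[m+kn]%n≡m%n h (s * (i + n′ * h)) p ⟩
      h % p                                  ≡⟨ DivMod.m<n⇒m%n≡m h<p ⟩
      h                                      ∎
      where
      open ≡-Reasoning
      r = reflect i h
      e = (i + n * h) / p
      n′ = pred n
      collect : ∀ i n r e p → i + n * r + n * e * p ≡ i + n * (r + e * p)
      collect = solve-∀
      expand : ∀ i n′ h → i + suc n′ * (i + suc n′ * h) ≡ h + suc (suc n′) * (i + n′ * h)
      expand = solve-∀
      regroup : ∀ h s p g → h + s * p * g ≡ h + s * g * p
      regroup = solve-∀

    -- The residue p - 1 arises from h ≡ i - (p - 1) ≡ i + 1, so that the operator picks the term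
    -- whose index is the last digit of a = i + 1.
    reflect-last : ∀ i → reflect i (p ∸ 1) ≡ suc i % p
    reflect-last i = begin
      (i + n * p′) % p           ≡⟨ DivMod.[m+n]%n≡m%n (i + n * p′) p ⟨
      (i + n * p′ + p) % p       ≡⟨ cong (λ q → (i + n * p′ + q) % p) (ℕₚ.m+[n∸m]≡n (ℕ.>-nonZero⁻¹ p)) ⟨
      (i + n * p′ + suc p′) % p  ≡⟨ cong (_% p) (collect i n p′) ⟩
      (suc i + suc n * p′) % p   ≡⟨ cong (λ N → (suc i + N * p′) % p) 1+n≡s*p ⟩
      (suc i + s * p * p′) % p   ≡⟨ cong (_% p) (regroup i s p p′) ⟩
      (suc i + s * p′ * p) % p   ≡⟨ DivMod.[m+kn]%n≡m%n (suc i) (s * p′) p ⟩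
      suc i % p                  ∎
      where
      open ≡-Reasoning
      p′ = p ∸ 1
      collect : ∀ i n p′ → i + n * p′ + suc p′ ≡ suc i + suc n * p′
      collect = solve-∀
      regroup : ∀ i s p p′ → suc i + s * p * p′ ≡ suc i + s * p′ * p
      regroup = solve-∀

    -- The origin of `exchange`: with a = k + q p, the exponent at h = k satisfies a + n k = q p +
    -- (n + 1) k = (q + s k) p.
    exchange-* : ∀ i → suc (i + n * (suc i % p)) ≡ exchange (suc i) * p
    exchange-* i = begin
      suc i + n * k      ≡⟨ cong (_+ n * k) (DivMod.m≡m%n+[m/n]*n (suc i) p) ⟩
      k + q * p + n * k  ≡⟨ collect k q p n ⟩
      q * p + suc n * k  ≡⟨ cong (λ N → q * p + N * k) 1+n≡s*p ⟩
      q * p + s * p * k  ≡⟨ regroup q p s k ⟩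
      (q + s * k) * p    ∎
      where
      open ≡-Reasoning
      k = suc i % p
      q = suc i / p
      collect : ∀ k q p n → k + q * p + n * k ≡ q * p + suc n * k
      collect = solve-∀
      regroup : ∀ q p s k → q * p + s * p * k ≡ (q + s * k) * p
      regroup = solve-∀

    target-quotient : ∀ i → (i + n * (suc i % p)) / p ≡ target i
    target-quotient i = suc[m]≡c*p⇒m/p≡pred[c] (exchange (suc i)) p (exchange-* i)

    -- The predecessor in `target` does not truncate: p times `exchange (suc i)` is a successor, so
    -- this factor is positive.
    suc-target : ∀ i → suc (target i) ≡ exchange (suc i)
    suc-target i = suc-pred-factor (exchange (suc i)) (exchange-* i)
      where
      suc-pred-factor : ∀ {m} c → suc m ≡ c * p → suc (pred c) ≡ c
      suc-pred-factor (suc c) _ = ≡.refl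

    -- As a / p < s, reducing q + s k modulo s recovers q, and then k is determined.
    exchange-injective : ∀ {a b} → a < s * p → b < s * p → exchange a ≡ exchange b → a ≡ b
    exchange-injective {a} {b} a<sp b<sp eq = begin
      a                  ≡⟨ DivMod.m≡m%n+[m/n]*n a p ⟩
      a % p + a / p * p  ≡⟨ cong₂ (λ k q → k + q * p) k≡l q≡t ⟩
      b % p + b / p * p  ≡⟨ DivMod.m≡m%n+[m/n]*n b p ⟨
      b                  ∎
      where
      open ≡-Reasoning
      low-digit : ∀ {a} → a < s * p → exchange a % s ≡ a / p
      low-digit {a} a<sp = ≡.trans
        (cong (λ m → (a / p + m) % s) (ℕₚ.*-comm s (a % p)))
        (≡.trans (DivMod.[m+kn]%n≡m%n (a / p) (a % p) s) (DivMod.m<n⇒m%n≡m (DivMod.m<n*o⇒m/o<n a<sp)))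
      q≡t : a / p ≡ b / p
      q≡t = ≡.trans (≡.sym (low-digit a<sp)) (≡.trans (cong (_% s) eq) (low-digit b<sp))
      k≡l : a % p ≡ b % p
      k≡l = ℕₚ.*-cancelˡ-≡ (a % p) (b % p) s (ℕₚ.+-cancelˡ-≡ (b / p) _ _
              (≡.trans (cong (_+ s * (a % p)) (≡.sym q≡t)) eq))

    target-injective : ∀ {i j} → i < n → j < n → target i ≡ target j → i ≡ j
    target-injective {i} {j} i<n j<n eq = ℕₚ.suc-injective (exchange-injective
      (subst (suc i <_) 1+n≡s*p (s≤s i<n)) (subst (suc j <_) 1+n≡s*p (s≤s j<n))
      (≡.trans (≡.sym (suc-target i)) (≡.trans (cong suc eq) (suc-target j))))

    -- With g = k + l and w = q + t, the new indices add up to w + s g, and w + s g + 2 ≤ s p is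
    -- required. If g ≤ p - 2, then w < s is enough. If g = p - 1, the bound a + b + 2 ≤ s p gives
    -- (w + 1) p < s p, hence w + 2 ≤ s.
    target-holomorphic : ∀ {i j} → i + j + 3 ≤ n → CarryFree (suc i) (suc j) →
      target i + target j + 3 ≤ n
    target-holomorphic {i} {j} i+j+3≤n g<p =
      ℕ.s≤s⁻¹ (to-n (ℕₚ.≤-trans (ℕₚ.≤-reflexive images) (bound (ℕₚ.m≤n⇒m<n∨m≡n g<p))))
      where
      k = suc i % p
      q = suc i / p
      l = suc j % p
      t = suc j / p
      g = k + l
      w = q + t
      to-n : suc (target i + target j + 3) ≤ s * p → suc (target i + target j + 3) ≤ suc n
      to-n = subst (suc (target i + target j + 3) ≤_) (≡.sym 1+n≡s*p)
      shift : ∀ i j → suc (i + j + 3) ≡ 2 + (suc i + suc j)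
      shift = solve-∀
      images : suc (target i + target j + 3) ≡ 2 + (w + s * g)
      images = ≡.trans (shift (target i) (target j))
        (≡.trans (cong (2 +_) (cong₂ _+_ (suc-target i) (suc-target j))) (regroup q k t l s))
        where
        regroup : ∀ q k t l s → 2 + ((q + s * k) + (t + s * l)) ≡ 2 + ((q + t) + s * (k + l))
        regroup = solve-∀
      digits : 2 + (g + w * p) ≤ s * p
      digits = begin
        2 + (g + w * p)                  ≡⟨ regroup k l q t p ⟩
        2 + ((k + q * p) + (l + t * p))  ≡⟨ cong₂ (λ a b → 2 + (a + b)) (DivMod.m≡m%n+[m/n]*n (suc i) p) (DivMod.m≡m%n+[m/n]*n (suc j) p) ⟨
        2 + (suc i + suc j)              ≡⟨ shift i j ⟨
        suc (i + j + 3)                  ≤⟨ s≤s i+j+3≤n ⟩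
        suc n                            ≡⟨ 1+n≡s*p ⟩
        s * p                            ∎
        where
        open ℕₚ.≤-Reasoning
        regroup : ∀ k l q t p → 2 + ((k + l) + (q + t) * p) ≡ 2 + ((k + q * p) + (l + t * p))
        regroup = solve-∀
      open ℕₚ.≤-Reasoning
      bound : suc g < p ⊎ suc g ≡ p → 2 + (w + s * g) ≤ s * p
      bound (inj₁ 1+g<p) = begin
        2 + (w + s * g)      ≡⟨ regroup w (s * g) ⟩
        1 + (suc w + s * g)  ≤⟨ ℕₚ.+-mono-≤ (ℕ.>-nonZero⁻¹ s) (ℕₚ.+-monoˡ-≤ (s * g) w<s) ⟩
        s + (s + s * g)      ≡⟨ factor s g ⟩
        s * (2 + g)          ≤⟨ ℕₚ.*-monoʳ-≤ s 1+g<p ⟩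
        s * p                ∎
        where
        w<s : w < s
        w<s = ℕₚ.*-cancelʳ-< p w s (ℕₚ.≤-trans (s≤s (ℕₚ.≤-trans (ℕₚ.m≤n+m (w * p) g) (ℕₚ.n≤1+n _))) digits)
        regroup : ∀ w m → 2 + (w + m) ≡ 1 + (suc w + m)
        regroup = solve-∀
        factor : ∀ s g → s + (s + s * g) ≡ s * (2 + g)
        factor = solve-∀
      bound (inj₂ 1+g≡p) = begin
        (2 + w) + s * g  ≤⟨ ℕₚ.+-monoˡ-≤ (s * g) 1+w<s ⟩
        s + s * g        ≡⟨ ℕₚ.*-suc s g ⟨
        s * suc g        ≡⟨ cong (s *_) 1+g≡p ⟩
        s * p            ∎
        where
        1+w<s : suc w < s
        1+w<s = ℕₚ.*-cancelʳ-< p (suc w) s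
          (ℕₚ.≤-trans (ℕₚ.≤-reflexive (cong (λ m → suc (m + w * p)) (≡.sym 1+g≡p))) digits)

    -- The exponent m with j + 2 + m ≡ 0 modulo p.
    complement : ℕ → ℕ
    complement j = p ∸ suc (suc j % p)

    digit+complement : ∀ j → suc (suc j % p) + complement j ≡ p
    digit+complement j = ℕₚ.m+[n∸m]≡n (DivMod.m%n<n (suc j) p)

    complement<p : ∀ j → complement j < p
    complement<p j = subst (complement j <_) (digit+complement j) (ℕₚ.m<n+m (complement j) (s≤s z≤n))

    carryFree⇒≤complement : ∀ {i j} → CarryFree (suc i) (suc j) → suc i % p ≤ complement j
    carryFree⇒≤complement {i} {j} k+l<p =
      ℕₚ.m+n≤o⇒m≤o∸n (suc i % p) (subst (_≤ p) (≡.sym (ℕₚ.+-suc (suc i % p) (suc j % p))) k+l<p)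

    ≤complement⇒carryFree : ∀ {i j} → suc i % p ≤ complement j → CarryFree (suc i) (suc j)
    ≤complement⇒carryFree {i} {j} k≤m = subst (_≤ p) (ℕₚ.+-suc (suc i % p) (suc j % p))
      (ℕₚ.m≤o∸n⇒m+n≤o (suc i % p) (DivMod.m%n<n (suc j) p) k≤m)

    -- The exponents in yʲ / yⁿ⁻¹ = (yᵗ⁺¹ / yˢ⁽ᵐ⁺¹⁾)ᵖ (yⁿ)ᵐ, arranged without
    -- subtraction; likewise below for (yᵗ⁺¹ / yˢ⁽ᵐ⁺¹⁾) yⁿ⁻¹ = y ^ target j.
    y-exponent : ∀ j → let m = complement j; t = suc j / p in
      suc t * p + n * m + (n ∸ 1) ≡ j + s * suc m * p
    y-exponent j = ℕₚ.suc-injective (begin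
      suc (suc t * p + n * m + (n ∸ 1))  ≡⟨ ℕₚ.+-suc _ (n ∸ 1) ⟨
      suc t * p + n * m + suc (n ∸ 1)    ≡⟨ cong (suc t * p + n * m +_) (ℕₚ.m+[n∸m]≡n (ℕ.>-nonZero⁻¹ n)) ⟩
      p + t * p + n * m + n              ≡⟨ cong (λ P → P + t * p + n * m + n) (digit+complement j) ⟨
      suc l + m + t * p + n * m + n      ≡⟨ collect l m (t * p) n ⟩
      (l + t * p) + suc n * suc m        ≡⟨ cong₂ (λ b N → b + N * suc m) (≡.sym (DivMod.m≡m%n+[m/n]*n (suc j) p)) 1+n≡s*p ⟩
      suc j + s * p * suc m              ≡⟨ cong (suc j +_) (regroup s p (suc m)) ⟩
      suc j + s * suc m * p              ∎)
      where
      open ≡-Reasoning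
      m = complement j
      t = suc j / p
      l = suc j % p
      collect : ∀ l m u n → suc l + m + u + n * m + n ≡ (l + u) + suc n * suc m
      collect = solve-∀
      regroup : ∀ a b c → a * b * c ≡ a * c * b
      regroup = solve-∀

    target-exponent : ∀ j → suc (suc j / p) + (n ∸ 1) ≡ target j + s * suc (complement j)
    target-exponent j = ℕₚ.suc-injective (begin
      suc (suc t + (n ∸ 1))       ≡⟨ ℕₚ.+-suc (suc t) (n ∸ 1) ⟨
      suc t + suc (n ∸ 1)         ≡⟨ cong (suc t +_) (ℕₚ.m+[n∸m]≡n (ℕ.>-nonZero⁻¹ n)) ⟩
      suc t + n                   ≡⟨ ℕₚ.+-suc t n ⟨
      t + suc n                   ≡⟨ cong (t +_) (≡.trans 1+n≡s*p (cong (s *_) (≡.sym (digit+complement j)))) ⟩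
      t + s * (suc l + m)         ≡⟨ regroup t s l m ⟩
      (t + s * l) + s * suc m     ≡⟨ cong (_+ s * suc m) (suc-target j) ⟨
      suc (target j) + s * suc m  ∎)
      where
      open ≡-Reasoning
      m = complement j
      t = suc j / p
      l = suc j % p
      regroup : ∀ t s l m → t + s * (suc l + m) ≡ (t + s * l) + s * suc m
      regroup = solve-∀

-- The Cartier operator on the basis forms.

module CartierComputation
  {c ℓ} {K : Field c ℓ} (closed : IsAlgebraicallyClosed K)
  {p : ℕ} .{{p≢0 : NonZero p}} (char : HasCharacteristic K p)
  {s n : ℕ} .{{s≢0 : NonZero s}} .{{n≢0 : NonZero n}} (1+n≡s*p : suc n ≡ s ℕ.* p)
  {c′ ℓ′} (FF : FermatFunctionField K n c′ ℓ′) where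
  private
    module K = Field K
    module Kₚ = FieldProperties K
  open FermatFunctionField FF
  open FieldProperties functionField
  open FermatProperties FF
  open Counting.Digits p
  open DigitExchanges.DigitExchange p s n 1+n≡s*p
  open DivMod using (_/_; _%_)
  open SetoidReasoning setoid
  open CommutativeMonoidSolver *-commutativeMonoid using (solve; _⊕_; _⊜_)

  -- Since p divides n + 1, it would otherwise divide 1.
  n·1≉0 : ¬ (n K.· K.1# K.≈ K.0#)
  n·1≉0 n·1≈0 = Kₚ.characteristic∤1 char (∣m+n∣m⇒∣n
    (subst (p ∣_) (≡.trans (≡.sym 1+n≡s*p) (ℕₚ.+-comm 1 n)) (n∣m*n s)) (Equivalence.to (char n) n·1≈0))

  ν : K.Carrier
  ν = (n K.· K.1#) K.⁻¹

  w : Carrier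
  w = n · y ^ (n ∸ 1)

  w≈ : w ≈ ι (n K.· K.1#) * y ^ (n ∸ 1)
  w≈ = begin
    n · y ^ (n ∸ 1)               ≈⟨ ×-congʳ n (*-identityˡ _) ⟨
    n · (1# * y ^ (n ∸ 1))        ≈⟨ ×-assoc-* n 1# _ ⟨
    n · 1# * y ^ (n ∸ 1)          ≈⟨ *-congʳ (ι-·1 n) ⟨
    ι (n K.· K.1#) * y ^ (n ∸ 1)  ∎

  w≉0 : ¬ (w ≈ 0#)
  w≉0 w≈0 = *-nonZero (ι-nonZero n·1≉0) (^-nonZero (n ∸ 1) y≉0) (trans (sym w≈) w≈0)

  w⁻¹*w≈1 : w ⁻¹ * w ≈ 1#
  w⁻¹*w≈1 = trans (*-comm _ _) (⁻¹-right w w≉0)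

  form : ℕ × ℕ → Carrier
  form (i , j) = x ^ i * y ^ j * w ⁻¹

  form*w : ∀ i j → form (i , j) * w ≈ x ^ i * y ^ j
  form*w i j = trans (*-assoc _ _ _) (trans (*-congˡ w⁻¹*w≈1) (*-identityʳ _))

  e : Fin (genus n) → ℕ × ℕ
  e = lookup (exponents n)

  e-bound : ∀ k → proj₁ (e k) ℕ.+ proj₂ (e k) ℕ.+ 3 ≤ n
  e-bound k = ∈-exponents⁻ (∈-lookup k)

  summand<n : ∀ {i j} → i ℕ.+ j ℕ.+ 3 ≤ n → i < n × j < n
  summand<n {i} {j} i+j+3≤n = below (ℕₚ.m≤m+n i j) , below (ℕₚ.m≤n+m j i)
    where
    below : ∀ {k} → k ≤ i ℕ.+ j → k < n
    below {k} k≤i+j = ℕₚ.<-≤-trans (ℕₚ.≤-<-trans k≤i+j (ℕₚ.m<m+n (i ℕ.+ j) (s≤s z≤n))) i+j+3≤n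

  e-injective : ∀ k l → e k ≡ e l → k ≡ l
  e-injective = lookup-injective (exponents-unique n)

  -- Multiplying the difference of the two sides by the common denominator `w` yields a relation
  -- between monomials with X-exponents below n. This is what determines the entries of the matrix
  -- from identities between differentials.
  combination≈⇒≈ : ∀ (a b : Vector K.Carrier (genus n)) →
    sum (λ k → ι (a k) * form (e k)) ≈ sum (λ k → ι (b k) * form (e k)) → ∀ k → a k K.≈ b k
  combination≈⇒≈ a b eq k = K-Group.x∙y⁻¹≈ε⇒x≈y (a k) (b k)
    (monomials-independent d e e-injective (λ k → proj₁ (summand<n (e-bound k))) d-relation k)
    where
    module K-Group = GroupProperties K.+-group
    d : Vector K.Carrier (genus n)
    d k = a k K.- b k

    F : Vector K.Carrier (genus n) → Carrier
    F a = sum (λ k → ι (a k) * form (e k))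

    d+b≈a : ∀ k → ι (d k) * form (e k) + ι (b k) * form (e k) ≈ ι (a k) * form (e k)
    d+b≈a k = trans (sym (distribʳ _ _ _)) (*-congʳ (trans (sym (ι-+ (d k) (b k)))
      (ι-cong (K-Group.//-rightDividesˡ (b k) (a k)))))

    d≈0 : F d ≈ 0#
    d≈0 = GroupProperties.identityˡ-unique +-group (F d) (F b) (begin
      F d + F b                                                ≈⟨ ∑-distrib-+ {genus n} (λ k → ι (d k) * form (e k)) (λ k → ι (b k) * form (e k)) ⟨
      sum (λ k → ι (d k) * form (e k) + ι (b k) * form (e k))  ≈⟨ sum-cong-≋ {genus n} d+b≈a ⟩
      F a                                                      ≈⟨ eq ⟩
      F b                                                      ∎)

    d-relation : sum (λ k → ι (d k) * x ^ proj₁ (e k) * y ^ proj₂ (e k)) ≈ 0#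
    d-relation = begin
      sum (λ k → ι (d k) * x ^ proj₁ (e k) * y ^ proj₂ (e k))
        ≈⟨ sum-cong-≋ {genus n} (λ k → trans (*-assoc _ _ _) (trans (*-congˡ (sym (form*w (proj₁ (e k)) (proj₂ (e k))))) (sym (*-assoc _ _ _)))) ⟩
      sum (λ k → ι (d k) * form (e k) * w)  ≈⟨ *-distribʳ-sum {genus n} w (λ k → ι (d k) * form (e k)) ⟨
      F d * w                               ≈⟨ *-congʳ d≈0 ⟩
      0# * w                                ≈⟨ zeroˡ w ⟩
      0#                                    ∎

  y^[a+b]*y⁻¹^b : ∀ a b → y ^ (a ℕ.+ b) * (y ⁻¹) ^ b ≈ y ^ a
  y^[a+b]*y⁻¹^b a b = begin
    y ^ (a ℕ.+ b) * (y ⁻¹) ^ b    ≈⟨ *-congʳ (^-homo-* y a b) ⟩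
    y ^ a * y ^ b * (y ⁻¹) ^ b    ≈⟨ *-assoc _ _ _ ⟩
    y ^ a * (y ^ b * (y ⁻¹) ^ b)  ≈⟨ *-congˡ (^-distrib-* y (y ⁻¹) b) ⟨
    y ^ a * (y * y ⁻¹) ^ b        ≈⟨ *-congˡ (trans (^-congˡ b (⁻¹-right y y≉0)) (1^n≈1 b)) ⟩
    y ^ a * 1#                    ≈⟨ *-identityʳ _ ⟩
    y ^ a                         ∎

  -- The coefficient of x^(n h) in (y^n)^m = (-1)^m (1 + x^n)^m.
  signedBinomial : ℕ → ℕ → K.Carrier
  signedBinomial m h = (K.- K.1#) K.^ m K.* (m choose h) K.· K.1#

  -- For h > m the root is given explicitly, as z ^ p ≈ 0# does not constructively
  -- imply z ≈ 0#.
  root : ∀ {m} → m < p → ∀ h → ∃[ z ]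
    z K.^ p K.≈ ν K.* signedBinomial m h × (h ≤ m → ¬ (z K.≈ K.0#)) × (¬ (h ≤ m) → z K.≈ K.0#)
  root {m} m<p h with h ℕₚ.≤? m
  ... | yes h≤m = let z , z^p≈ = Kₚ.algebraicallyClosed⇒root closed p (ν K.* signedBinomial m h) in
    z , z^p≈ , (λ _ z≈0 → nonZero (K.trans (K.sym z^p≈) (K.trans (Kₚ.^-congˡ p z≈0) (Kₚ.0^n≈0 p)))) , contradiction h≤m
    where
    nonZero : ¬ (ν K.* signedBinomial m h K.≈ K.0#)
    nonZero = Kₚ.*-nonZero (Kₚ.⁻¹-nonZero n·1≉0)
      (Kₚ.*-nonZero (Kₚ.^-nonZero m Kₚ.-1≉0) (Kₚ.binomial-nonZero char m<p h≤m))
  ... | no h≰m = K.0# , K.trans (Kₚ.0^n≈0 p) (K.sym (K.trans (K.*-congˡ (K.trans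
      (K.*-congˡ (Kₚ.×-congˡ (k>n⇒nCk≡0 (ℕₚ.≰⇒> h≰m)))) (K.zeroʳ _))) (K.zeroʳ ν))) ,
    (λ h≤m → contradiction h≤m h≰m) , λ _ → K.refl

  -- The expansion of a basis form with p-th power coefficients.

  module Expansion (i j : ℕ) where
    m = complement j

    B = s ℕ.* suc m

    -- Chosen so that y^j / y^(n-1) = V^p (y^n)^m; the remaining power of y^n is then expanded in x.
    V : Carrier
    V = y ^ suc (suc j / p) * (y ⁻¹) ^ B

    z : ℕ → K.Carrier
    z h = proj₁ (root (complement<p j) h)

    -- The index h with i + n h ≡ r modulo p is `reflect i r`; what remains of its term after
    -- splitting off x^r is a p-th power, and this is its root.
    u : ℕ → Carrier
    u r = ι (z (reflect i r)) * V * x ^ ((i ℕ.+ n ℕ.* reflect i r) / p)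

    V*yⁿ⁻¹ : V * y ^ (n ∸ 1) ≈ y ^ target j
    V*yⁿ⁻¹ = begin
      y ^ suc (suc j / p) * (y ⁻¹) ^ B * y ^ (n ∸ 1)
        ≈⟨ solve 3 (λ a b c → (a ⊕ b) ⊕ c ⊜ (a ⊕ c) ⊕ b) refl _ _ _ ⟩
      y ^ suc (suc j / p) * y ^ (n ∸ 1) * (y ⁻¹) ^ B  ≈⟨ *-congʳ (^-homo-* y (suc (suc j / p)) (n ∸ 1)) ⟨
      y ^ (suc (suc j / p) ℕ.+ (n ∸ 1)) * (y ⁻¹) ^ B  ≈⟨ *-congʳ (^-congʳ y (target-exponent j)) ⟩
      y ^ (target j ℕ.+ B) * (y ⁻¹) ^ B               ≈⟨ y^[a+b]*y⁻¹^b (target j) B ⟩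
      y ^ target j                                    ∎

    Vᵖ*yⁿᵐ*yⁿ⁻¹ : V ^ p * (y ^ n) ^ m * y ^ (n ∸ 1) ≈ y ^ j
    Vᵖ*yⁿᵐ*yⁿ⁻¹ = begin
      V ^ p * (y ^ n) ^ m * y ^ (n ∸ 1)
        ≈⟨ *-congʳ (*-cong (trans (^-distrib-* _ _ p) (*-cong (^-assocʳ y (suc t) p) (^-assocʳ (y ⁻¹) B p))) (^-assocʳ y n m)) ⟩
      y ^ (suc t ℕ.* p) * (y ⁻¹) ^ (B ℕ.* p) * y ^ (n ℕ.* m) * y ^ (n ∸ 1)
        ≈⟨ solve 4 (λ a b c d → ((a ⊕ b) ⊕ c) ⊕ d ⊜ ((a ⊕ c) ⊕ d) ⊕ b) refl _ _ _ _ ⟩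
      y ^ (suc t ℕ.* p) * y ^ (n ℕ.* m) * y ^ (n ∸ 1) * (y ⁻¹) ^ (B ℕ.* p)
        ≈⟨ *-congʳ (trans (^-homo-* y (suc t ℕ.* p ℕ.+ n ℕ.* m) (n ∸ 1)) (*-congʳ (^-homo-* y (suc t ℕ.* p) (n ℕ.* m)))) ⟨
      y ^ (suc t ℕ.* p ℕ.+ n ℕ.* m ℕ.+ (n ∸ 1)) * (y ⁻¹) ^ (B ℕ.* p)
        ≈⟨ *-congʳ (^-congʳ y (y-exponent j)) ⟩
      y ^ (j ℕ.+ B ℕ.* p) * (y ⁻¹) ^ (B ℕ.* p)  ≈⟨ y^[a+b]*y⁻¹^b j (B ℕ.* p) ⟩
      y ^ j                                     ∎
      where t = suc j / p

    ι-n·1*ν : ι (n K.· K.1#) * ι ν ≈ 1#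
    ι-n·1*ν = trans (sym (ι-* _ ν)) (trans (ι-cong (K.⁻¹-right _ n·1≉0)) ι-1)

    form≈ : form (i , j) ≈ ι ν * x ^ i * (V ^ p * (y ^ n) ^ m)
    form≈ = *-cancelʳ-nonZero w≉0 (begin
      form (i , j) * w                                    ≈⟨ form*w i j ⟩
      x ^ i * y ^ j                                       ≈⟨ *-congˡ Vᵖ*yⁿᵐ*yⁿ⁻¹ ⟨
      x ^ i * (V ^ p * (y ^ n) ^ m * y ^ (n ∸ 1))         ≈⟨ *-identityˡ _ ⟨
      1# * (x ^ i * (V ^ p * (y ^ n) ^ m * y ^ (n ∸ 1)))  ≈⟨ *-congʳ ι-n·1*ν ⟨
      ι (n K.· K.1#) * ι ν * (x ^ i * (V ^ p * (y ^ n) ^ m * y ^ (n ∸ 1)))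
        ≈⟨ solve 5 (λ a b c d e → (a ⊕ b) ⊕ (c ⊕ (d ⊕ e)) ⊜ ((b ⊕ c) ⊕ d) ⊕ (a ⊕ e)) refl _ _ _ _ _ ⟩
      ι ν * x ^ i * (V ^ p * (y ^ n) ^ m) * (ι (n K.· K.1#) * y ^ (n ∸ 1))  ≈⟨ *-congˡ w≈ ⟨
      ι ν * x ^ i * (V ^ p * (y ^ n) ^ m) * w                               ∎)

    term : ℕ → Carrier
    term h = ι (z h) ^ p * V ^ p * x ^ (i ℕ.+ n ℕ.* h)

    yⁿᵐ≈ : (y ^ n) ^ m ≈ sum {p} λ h → ι (signedBinomial m (toℕ h)) * x ^ (n ℕ.* toℕ h)
    yⁿᵐ≈ = begin
      (y ^ n) ^ m                                                        ≈⟨ ^-congˡ m yⁿ≈-[1+xⁿ] ⟩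
      (- 1# * (1# + x ^ n)) ^ m                                          ≈⟨ ^-distrib-* _ _ m ⟩
      (- 1#) ^ m * (1# + x ^ n) ^ m                                      ≈⟨ *-congˡ ([1+x]^m≈∑ (complement<p j) (x ^ n)) ⟩
      (- 1#) ^ m * sum {p} (λ h → (m choose toℕ h) · (x ^ n) ^ toℕ h)    ≈⟨ *-distribˡ-sum {p} ((- 1#) ^ m) (λ h → (m choose toℕ h) · (x ^ n) ^ toℕ h) ⟩
      sum {p} (λ h → (- 1#) ^ m * ((m choose toℕ h) · (x ^ n) ^ toℕ h))  ≈⟨ sum-cong-≋ {p} (λ h → coefficient≈ (toℕ h)) ⟩
      sum {p} (λ h → ι (signedBinomial m (toℕ h)) * x ^ (n ℕ.* toℕ h))   ∎
      where
      coefficient≈ : ∀ h → (- 1#) ^ m * ((m choose h) · (x ^ n) ^ h) ≈ ι (signedBinomial m h) * x ^ (n ℕ.* h)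
      coefficient≈ h = begin
        (- 1#) ^ m * ((m choose h) · (x ^ n) ^ h)
          ≈⟨ *-congˡ (trans (×-congʳ (m choose h) (sym (*-identityˡ _))) (sym (×-assoc-* (m choose h) 1# _))) ⟩
        (- 1#) ^ m * ((m choose h) · 1# * (x ^ n) ^ h)                        ≈⟨ *-assoc _ _ _ ⟨
        (- 1#) ^ m * (m choose h) · 1# * (x ^ n) ^ h
          ≈⟨ *-cong (*-cong (trans (ι-^ _ m) (^-congˡ m (trans (ι-neg K.1#) (-‿cong ι-1)))) (ι-·1 (m choose h))) (sym (^-assocʳ x n h)) ⟨
        ι ((K.- K.1#) K.^ m) * ι ((m choose h) K.· K.1#) * x ^ (n ℕ.* h)  ≈⟨ *-congʳ (ι-* _ _) ⟨
        ι (signedBinomial m h) * x ^ (n ℕ.* h)                            ∎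

    form≈∑term : form (i , j) ≈ sum {p} (term ∘ toℕ)
    form≈∑term = begin
      form (i , j)                         ≈⟨ form≈ ⟩
      ι ν * x ^ i * (V ^ p * (y ^ n) ^ m)  ≈⟨ *-assoc _ _ _ ⟨
      ι ν * x ^ i * V ^ p * (y ^ n) ^ m    ≈⟨ *-congˡ yⁿᵐ≈ ⟩
      ι ν * x ^ i * V ^ p * sum {p} (λ h → ι (signedBinomial m (toℕ h)) * x ^ (n ℕ.* toℕ h))
        ≈⟨ *-distribˡ-sum {p} (ι ν * x ^ i * V ^ p) (λ h → ι (signedBinomial m (toℕ h)) * x ^ (n ℕ.* toℕ h)) ⟩
      sum {p} (λ h → ι ν * x ^ i * V ^ p * (ι (signedBinomial m (toℕ h)) * x ^ (n ℕ.* toℕ h)))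
        ≈⟨ sum-cong-≋ {p} (λ h → term≈ (toℕ h)) ⟩
      sum {p} (term ∘ toℕ)                                               ∎
      where
      term≈ : ∀ h → ι ν * x ^ i * V ^ p * (ι (signedBinomial m h) * x ^ (n ℕ.* h)) ≈ term h
      term≈ h = begin
        ι ν * x ^ i * V ^ p * (ι (signedBinomial m h) * x ^ (n ℕ.* h))
          ≈⟨ solve 5 (λ a b c d e → ((a ⊕ b) ⊕ c) ⊕ (d ⊕ e) ⊜ ((a ⊕ d) ⊕ c) ⊕ (b ⊕ e)) refl _ _ _ _ _ ⟩
        ι ν * ι (signedBinomial m h) * V ^ p * (x ^ i * x ^ (n ℕ.* h))
          ≈⟨ *-cong (*-congʳ (trans (sym (ι-* _ _)) (trans (ι-cong (K.sym (proj₁ (proj₂ (root (complement<p j) h))))) (ι-^ (z h) p))))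
               (sym (^-homo-* x i (n ℕ.* h))) ⟩
        term h ∎

    reflection : Permutation′ p
    reflection = permutation ρ ρ ρ-involutive ρ-involutive
      where
      ρ : Fin p → Fin p
      ρ h = fromℕ< (DivMod.m%n<n (i ℕ.+ n ℕ.* toℕ h) p)
      ρ-involutive : ∀ h → ρ (ρ h) ≡ h
      ρ-involutive h = Finₚ.toℕ-injective (≡.trans (Finₚ.toℕ-fromℕ< _)
        (≡.trans (cong (reflect i) (Finₚ.toℕ-fromℕ< _)) (reflect-involutive i (Finₚ.toℕ<n h))))

    expansion : form (i , j) ≈ sum {p} (λ r → u (toℕ r) ^ p * x ^ toℕ r)
    expansion = begin
      form (i , j)                                    ≈⟨ form≈∑term ⟩
      -- The terms, indexed by h so far, are reindexed by the residue r of i + n h modulo p.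
      sum {p} (term ∘ toℕ)                            ≈⟨ sum-permute (term ∘ toℕ) reflection ⟩
      sum {p} (λ r → term (toℕ (reflection ⟨$⟩ʳ r)))  ≈⟨ sum-cong-≋ {p} term-reflect ⟩
      sum {p} (λ r → u (toℕ r) ^ p * x ^ toℕ r)       ∎
      where
      term-reflect : ∀ r → term (toℕ (reflection ⟨$⟩ʳ r)) ≈ u (toℕ r) ^ p * x ^ toℕ r
      term-reflect r = begin
        term (toℕ (reflection ⟨$⟩ʳ r))                     ≈⟨ reflexive (cong term (Finₚ.toℕ-fromℕ< _)) ⟩
        ι (z h) ^ p * V ^ p * x ^ (i ℕ.+ n ℕ.* h)          ≈⟨ *-congˡ (^-congʳ x i+nh≡) ⟩
        ι (z h) ^ p * V ^ p * x ^ (E ℕ.* p ℕ.+ toℕ r)      ≈⟨ *-congˡ (^-homo-* x (E ℕ.* p) (toℕ r)) ⟩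
        ι (z h) ^ p * V ^ p * (x ^ (E ℕ.* p) * x ^ toℕ r)  ≈⟨ *-assoc _ _ _ ⟨
        ι (z h) ^ p * V ^ p * x ^ (E ℕ.* p) * x ^ toℕ r
          ≈⟨ *-congʳ (*-cong (^-distrib-* (ι (z h)) V p) (^-assocʳ x E p)) ⟨
        (ι (z h) * V) ^ p * (x ^ E) ^ p * x ^ toℕ r  ≈⟨ *-congʳ (^-distrib-* _ _ p) ⟨
        u (toℕ r) ^ p * x ^ toℕ r                    ∎
        where
        h = reflect i (toℕ r)
        E = (i ℕ.+ n ℕ.* h) / p
        i+nh≡ : i ℕ.+ n ℕ.* h ≡ E ℕ.* p ℕ.+ toℕ r
        i+nh≡ = ≡.trans (DivMod.m≡m%n+[m/n]*n (i ℕ.+ n ℕ.* h) p)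
          (≡.trans (cong (ℕ._+ E ℕ.* p) (reflect-involutive i (Finₚ.toℕ<n r))) (ℕₚ.+-comm (toℕ r) _))

    -- The n makes up for the n in the denominator n y^(n-1) of the target form.
    factor : K.Carrier
    factor = z (suc i % p) K.* n K.· K.1#

    u-last : u (p ∸ 1) ≈ ι factor * form (target i , target j)
    u-last = *-cancelʳ-nonZero w≉0 (begin
      u (p ∸ 1) * w
        ≈⟨ *-congʳ (reflexive (cong (λ h → ι (z h) * V * x ^ ((i ℕ.+ n ℕ.* h) / p)) (reflect-last i))) ⟩
      ι (z k) * V * x ^ ((i ℕ.+ n ℕ.* k) / p) * w
        ≈⟨ *-cong (*-congˡ (^-congʳ x (target-quotient i))) w≈ ⟩
      ι (z k) * V * x ^ target i * (ι (n K.· K.1#) * y ^ (n ∸ 1))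
        ≈⟨ solve 5 (λ a b c d e → ((a ⊕ b) ⊕ c) ⊕ (d ⊕ e) ⊜ (a ⊕ d) ⊕ (c ⊕ (b ⊕ e))) refl _ _ _ _ _ ⟩
      ι (z k) * ι (n K.· K.1#) * (x ^ target i * (V * y ^ (n ∸ 1)))
        ≈⟨ *-cong (sym (ι-* _ _)) (*-congˡ V*yⁿ⁻¹) ⟩
      ι factor * (x ^ target i * y ^ target j)     ≈⟨ *-congˡ (form*w (target i) (target j)) ⟨
      ι factor * (form (target i , target j) * w)  ≈⟨ *-assoc _ _ _ ⟨
      ι factor * form (target i , target j) * w    ∎)
      where k = suc i % p

    factor-nonZero : CarryFree (suc i) (suc j) → ¬ (factor K.≈ K.0#)
    factor-nonZero cf = Kₚ.*-nonZero
      (proj₁ (proj₂ (proj₂ (root (complement<p j) (suc i % p)))) (carryFree⇒≤complement cf)) n·1≉0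

    factor-zero : ¬ CarryFree (suc i) (suc j) → factor K.≈ K.0#
    factor-zero ¬cf = K.trans (K.*-congʳ
      (proj₂ (proj₂ (proj₂ (root (complement<p j) (suc i % p)))) (¬cf ∘ ≤complement⇒carryFree))) (K.zeroˡ _)

  -- The matrix of the operator and its rank.

  module _ (𝒞 : Differential FF → Differential FF) (isCartier : IsCartierOperator FF p 𝒞)
           (M : Matrix K (genus n) (genus n)) (isMatrix : IsMatrixOf FF 𝒞 M) where

    P : Fin (genus n) → Set
    P k = Surviving (e k)

    scalar : ℕ × ℕ → K.Carrier
    scalar (i , j) = Expansion.factor i j

    image : ℕ × ℕ → ℕ × ℕ
    image (i , j) = target i , target j

    column : ∀ k → sum (λ i → ι (M i k) * form (e i)) ≈
                   ι (scalar (e k)) * form (image (e k))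
    column k = trans (sym (isMatrix k)) (trans (isCartier _ u expansion) u-last)
      where open Expansion (proj₁ (e k)) (proj₂ (e k))

    σ∈ : ∀ {k} → P k → image (e k) ∈ exponents n
    σ∈ {k} surviving = ∈-exponents⁺ {n} {target (proj₁ (e k))} {target (proj₂ (e k))}
      (target-holomorphic (e-bound k) surviving)

    σ : ∀ {k} → P k → Fin (genus n)
    σ surviving = index (σ∈ surviving)

    -- Both vectors are coordinates of the same differential, and coordinates are unique.
    surviving-column : ∀ {k} (v : P k) i → M i k K.≈ scalar (e k) K.* Kₚ.δ (σ v) i
    surviving-column {k} v = combination≈⇒≈ (λ i → M i k) (λ i → scalar (e k) K.* Kₚ.δ (σ v) i) (begin
      sum (λ i → ι (M i k) * form (e i))                                          ≈⟨ column k ⟩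
      ι (scalar (e k)) * form (image (e k))
        ≈⟨ *-congˡ (reflexive (cong form (lookup-index (σ∈ v)))) ⟩
      ι (scalar (e k)) * form (e (σ v))
        ≈⟨ *-congʳ (ι-cong (K.trans (K.*-congˡ (Kₚ.δ-diagonal (σ v))) (K.*-identityʳ _))) ⟨
      ι (scalar (e k) K.* Kₚ.δ (σ v) (σ v)) * form (e (σ v))
        ≈⟨ ∑-select (λ i → ι (scalar (e k) K.* Kₚ.δ (σ v) i) * form (e i)) (σ v) (λ i i≢σ →
             trans (*-congʳ (trans (ι-cong (K.trans (K.*-congˡ (Kₚ.δ-off-diagonal i≢σ)) (K.zeroʳ _))) ι-0)) (zeroˡ _)) ⟨
      sum (λ i → ι (scalar (e k) K.* Kₚ.δ (σ v) i) * form (e i))                  ∎)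

    lost-column : ∀ {k} → ¬ P k → ∀ i → M i k K.≈ K.0#
    lost-column {k} ¬v = combination≈⇒≈ (λ i → M i k) (λ _ → K.0#) (begin
      sum (λ i → ι (M i k) * form (e i))                                          ≈⟨ column k ⟩
      ι (scalar (e k)) * form (image (e k))
        ≈⟨ *-congʳ (trans (ι-cong (Expansion.factor-zero (proj₁ (e k)) (proj₂ (e k)) ¬v)) ι-0) ⟩
      0# * form (image (e k))          ≈⟨ zeroˡ _ ⟩
      0#                               ≈⟨ ∑-zero {genus n} _ (λ i → trans (*-congʳ ι-0) (zeroˡ (form (e i)))) ⟨
      sum (λ i → ι K.0# * form (e i))  ∎)

    σ-injective : ∀ {j k} (u : P j) (v : P k) → σ u ≡ σ v → j ≡ k
    σ-injective {j} {k} u v eq = e-injective j k (cong₂ _,_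
      (target-injective (proj₁ (summand<n (e-bound j))) (proj₁ (summand<n (e-bound k))) (cong proj₁ targets))
      (target-injective (proj₂ (summand<n (e-bound j))) (proj₂ (summand<n (e-bound k))) (cong proj₂ targets)))
      where
      targets = ≡.trans (lookup-index (σ∈ u)) (≡.trans (cong e eq) (≡.sym (lookup-index (σ∈ v))))

    -- Taking p-th powers of the entries preserves which of them vanish, so the monomial shape of
    -- `M` carries over.
    rank : HasRank K (entrywisePower K p M) (length (filter (λ k → surviving? (e k)) (allFin (genus n))))
    rank = Kₚ.monomial-rank (entrywisePower K p M) (λ k → surviving? (e k)) σ σ-injective
      (λ {k} v → Kₚ.^-nonZero p λ M≈0 → Expansion.factor-nonZero (proj₁ (e k)) (proj₂ (e k)) v
        (K.trans (K.sym (K.trans (K.*-congˡ (Kₚ.δ-diagonal (σ v))) (K.*-identityʳ _)))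
                 (K.trans (K.sym (surviving-column v (σ v))) M≈0)))
      (λ v i i≢σ → vanish (K.trans (surviving-column v i)
        (K.trans (K.*-congˡ (Kₚ.δ-off-diagonal i≢σ)) (K.zeroʳ _))))
      (λ ¬v i → vanish (lost-column ¬v i))
      where
      vanish : ∀ {a} → a K.≈ K.0# → a K.^ p K.≈ K.0#
      vanish a≈0 = K.trans (Kₚ.^-congˡ p a≈0) (Kₚ.0^n≈0 p)

open import Data.Integer.Base using (+_)
open import Data.Nat.Base using (_*_)
open import Data.Rational.Base using (_/_)

proposition3p6 : ∀ {c ℓ c′ ℓ′} (K : Field c ℓ) → IsAlgebraicallyClosed K →
    (p : ℕ) → 0 < p → HasCharacteristic K p →
    (s : ℕ) → 1 ≤ s →
    (FF : FermatFunctionField K (s * p ∸ 1) c′ ℓ′) →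
    (C : Differential FF → Differential FF) → IsCartierOperator FF p C →
    (M : Matrix K (genus (s * p ∸ 1)) (genus (s * p ∸ 1))) → IsMatrixOf FF C M →
    ∃[ r ] (HasRank K (entrywisePower K p M) r × (+ r / 1 ≡ rankFormula p s))
proposition3p6 K closed p 0<p char s 1≤s FF 𝒞 isCartier M isMatrix =
  r , CartierComputation.rank closed char 1+n≡s*p FF 𝒞 isCartier M isMatrix , RankFormula.rankFormula≡ p s r 1≤s (RankFormula.count p s n r 1+n≡s*p counted)
  where
  n = s * p ∸ 1

  -- For s, p ≥ 1 the difference s p - 1 vanishes only at s = p = 1; excluding p = 1 makes n
  -- positive.
  p≢1 : p ≢ 1
  p≢1 ≡.refl = FieldProperties.characteristic∤1 K char ∣-refl

  1+n≡s*p : suc n ≡ s * p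
  1+n≡s*p = ℕₚ.m+[n∸m]≡n (ℕₚ.*-mono-≤ 1≤s 0<p)

  1≤n : 1 ≤ n
  1≤n = ℕ.s≤s⁻¹ (ℕₚ.≤-trans (ℕₚ.*-mono-≤ 1≤s (ℕₚ.≤∧≢⇒< 0<p (p≢1 ∘ ≡.sym))) (ℕₚ.≤-reflexive (≡.sym 1+n≡s*p)))

  instance
    p≢0 = ℕ.>-nonZero 0<p
    s≢0 = ℕ.>-nonZero 1≤s
    n≢0 = ℕ.>-nonZero 1≤n

  open Counting.Digits p

  r = length (filter (λ k → surviving? (lookup (exponents n) k)) (allFin (genus n)))

  counted : 4 * r ℕ.+ 12 * n ≡ (s * suc s) * (p * suc p)
  counted = ≡.trans (cong (λ r → 4 * r ℕ.+ 12 * n) (length-filter-lookup surviving? (exponents n)))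
                    (4*survivors s n 1+n≡s*p 1≤n)
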